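{- Let $i\in\{7,23\}$ and let $n$ be a positive integer. Then $\mathcal{J}_{10}(40n+i)$ and $\mathcal{J}^*_{10}(40n+i)$ are both even.
   Context: Let $q=e^{2\pi i\tau}$ with $\tau$ in the upper half-plane, and let $\eta(\tau)=q^{1/24}\prod_{n\ge1}(1-q^n)$ be the Dedekind eta function. Define the Hauptmoduln \[ j_{10}(\tau)=\frac{\eta(2\tau)\eta(5\tau)^5}{\eta(\tau)\eta(10\tau)^5}-1=\frac1q+\sum_{n\ge1}\mathcal{J}_{10}(n)q^n, \] \[ j_{10}^*(\tau)=\left(\frac{\eta(\tau)\eta(5\tau)}{\eta(2\tau)\eta(10\tau)}\right)^4+4+2^4\left(\frac{\eta(2\tau)\eta(10\tau)}{\eta(\tau)\eta(5\tau)}\right)^4=\frac1q+\sum_{n\ge0}\mathcal{J}^*_{10}(n)q^n, \] so $\mathcal{J}_{10}(n)$ and $\mathcal{J}^*_{10}(n)$ denote their $n$-th Fourier coefficients (integers). -}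

module Defs where

open import Data.Nat as ℕ using (ℕ; zero; suc)
open import Data.Nat.Divisibility using (_∣?_)
open import Data.Integer as ℤ using (ℤ; +_; -[1+_])
open import Data.List using (List; []; _∷_)
open import Data.Product using (_×_; _,_)
open import Relation.Nullary.Decidable using (does)
open import Data.Bool using (if_then_else_)

Series : Set
Series = ℕ → ℤ

oneS : Series
oneS zero    = + 1
oneS (suc _) = + 0

sumTo : (ℕ → ℤ) → ℕ → ℤ
sumTo f zero    = f zero
sumTo f (suc N) = sumTo f N ℤ.+ f (suc N)

_⊛_ : Series → Series → Series
(f ⊛ g) N = sumTo (λ k → f k ℤ.* g (N ℕ.∸ k)) N

powS : Series → ℕ → Series
powS s zero    = oneS
powS s (suc k) = powS s k ⊛ s

oneMinus : ℕ → Series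
oneMinus m N =
  (if does (N ℕ.≟ 0) then + 1 else + 0) ℤ.-
  (if does (N ℕ.≟ m) then + 1 else + 0)

-- the series 1/(1 - q^m) = Σ_k q^{mk}  (used with m ≥ 1)
geom : ℕ → Series
geom m N = if does (m ∣? N) then + 1 else + 0

factorPow : ℕ → ℤ → Series
factorPow m (+ k)    = powS (oneMinus m) k
factorPow m -[1+ k ] = powS (geom m) (suc k)

prodTo : (ℕ → Series) → ℕ → Series
prodTo f zero    = oneS
prodTo f (suc K) = prodTo f K ⊛ f (suc K)

-- infinite product ∏_{n≥1} f n, where f n ≡ 1 mod q^n:
-- its N-th coefficient equals that of the truncation at n = N.
infProd : (ℕ → Series) → Series
infProd f N = prodTo f N N

-- ∏_{(d,r)} ∏_{n≥1} (1 - q^{d n})^r   (eta quotient without the q-power)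
etaProd : List (ℕ × ℤ) → Series
etaProd []              = oneS
etaProd ((d , r) ∷ ds) = infProd (λ n → factorPow (d ℕ.* n) r) ⊛ etaProd ds

-- η(2τ)η(5τ)^5 / (η(τ)η(10τ)^5) = q^{-1} · P10(q)
P10 : Series
P10 = etaProd ((2 , + 1) ∷ (5 , + 5) ∷ (1 , -[1+ 0 ]) ∷ (10 , -[1+ 4 ]) ∷ [])

-- (η(τ)η(5τ)/(η(2τ)η(10τ)))^4 = q^{-1} · A(q)
A10 : Series
A10 = etaProd ((1 , + 4) ∷ (5 , + 4) ∷ (2 , -[1+ 3 ]) ∷ (10 , -[1+ 3 ]) ∷ [])

-- (η(2τ)η(10τ)/(η(τ)η(5τ)))^4 = q · B(q)
B10 : Series
B10 = etaProd ((2 , + 4) ∷ (10 , + 4) ∷ (1 , -[1+ 3 ]) ∷ (5 , -[1+ 3 ]) ∷ [])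

-- 𝒥₁₀(n): coefficient of q^n (n ≥ 0) in j₁₀ = q^{-1} P10(q) - 1
J10 : ℕ → ℤ
J10 zero    = P10 1 ℤ.- + 1
J10 (suc n) = P10 (suc (suc n))

-- 𝒥*₁₀(n): coefficient of q^n (n ≥ 0) in j*₁₀ = q^{-1} A(q) + 4 + 16 q B(q)
J10* : ℕ → ℤ
J10* zero    = A10 1 ℤ.+ + 4
J10* (suc n) = A10 (suc (suc n)) ℤ.+ + 16 ℤ.* B10 n

{-# OPTIONS --safe #-}
module Submission where

-- Write fₖ = ∏ (1 + Xᵏⁿ) over a ring of characteristic 2, so that f₂ₖ = fₖ². The key identity is
--   f₁ f₅ = f₁⁶ + X f₅⁶.
-- With V = f₁²/f₅ it gives X (j₁₀ + 1) ≡ f₁/f₅⁵ = Z² + X, where Z = f₁³/f₅³ = V⁴ + X (f₁f₅)², and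
-- X j₁₀* ≡ Y⁴, where Y = 1/(f₁f₅) = V² + X (f₅²/f₁)². Since squares have no odd coefficients, the
-- coefficients at 8m of both are V(m)⁸, and V(m) = 0 for m ≡ 1, 3 mod 5, because f₁ is supported on
-- the pentagonal numbers, which are 0, 1, 2 mod 5.
--
-- For the key identity, split f₁ = α + β + γ by residues mod 5. Comparing with the triangular
-- series f₁³ gives αγ = β² and β = X f₂₅, and the norm ∏ f₁(ζⁱX) over the fifth roots of unity gives
-- (α⁵ + β⁵ + γ⁵) f₂₅ = f₅⁶. Hence the discrepancy d = f₁f₅ + f₁⁶ + X f₅⁶ satisfies
-- d(X) f₁(X²⁵) = f₁(X) d(X⁵), which forces d = 0.

open import Defs
open import Algebra.Bundles using (CommutativeRing; CommutativeSemiring; RawRing)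
import Algebra.Properties.CommutativeSemiring.Exp as CommutativeExp
import Algebra.Properties.Semiring.Exp as Exp
import Algebra.Properties.Semiring.Mult as Mult
import Algebra.Solver.Ring as RingSolver
open import Algebra.Solver.Ring.AlmostCommutativeRing using (fromCommutativeSemiring; _-Raw-AlmostCommutative⟶_)
open import Algebra.Structures.Biased using (IsCommutativeSemiringˡ; IsCommutativeMonoidˡ)
open import Data.Bool using (Bool; true; false; _xor_; _∧_; if_then_else_)
import Data.Bool.Properties as Bool
open import Data.Integer as ℤ using (ℤ; +_; -[1+_]; ∣_∣)
import Data.Integer.Properties as ℤ
open import Data.List using (List; []; _∷_)
open import Data.List.Relation.Unary.All using (All; []; _∷_)
open import Data.Maybe using (Maybe; just; nothing)
open import Data.Nat as ℕ using (ℕ; zero; suc; z≤n; s≤s; NonZero; _%_)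
open import Data.Nat.Divisibility as ℕ using (_∤_; _∣?_; _∣0; >⇒∤; ∣-refl; ∣m∣n⇒∣m+n; ∣m+n∣m⇒∣n)
open import Data.Nat.DivMod using (%-distribˡ-+; m≡m%n+[m/n]*n; [m+kn]%n≡m%n)
open import Data.Nat.Induction using (<-rec)
import Data.Nat.Properties as ℕ
open import Data.Nat.Tactic.RingSolver using (solve-∀)
open import Data.Product using (_×_; _,_)
open import Data.Sum using (_⊎_; inj₁; inj₂)
open import Level using (0ℓ)
open import Relation.Binary.PropositionalEquality as ≡ using (_≡_; _≢_)
import Relation.Binary.Reasoning.Setoid as SetoidReasoning
open import Relation.Binary.Structures using (IsEquivalence)
open import Relation.Nullary using (¬_; Dec; yes; no; does; contradiction)

-- The norm requires a primitive fifth root of unity. Since 2 has order 4 modulo 5, the smallest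
-- field of characteristic 2 containing one is `𝔽₁₆`, and the integer coefficients are reduced into
-- it rather than into the prime field. Commutative semirings suffice because every element is its
-- own negative once `1 + 1 ≈ 0`.
--
-- The classes modulo 40 come from the factor 1/q: the coefficients at 40n+7 and 40n+23 sit at
-- 8(5n+1) and 8(5n+3) in the series without that factor. Squaring doubles the residues 0, 1, 2 of
-- f₁ to 0, 2, 4, and division by f₅, a series in X⁵, preserves them; this leaves out 1 and 3.
--
-- The equation for d decides everything by orders of vanishing: if d had positive order n, the left
-- side would have order n and the right side order 5n. Order 0 is invariant under this
-- multiplication, so the constant term of d is computed directly.

HasChar2 : ∀ {c ℓ} → CommutativeSemiring c ℓ → Set ℓ
HasChar2 R = 1# + 1# ≈ 0#
  where open CommutativeSemiring R

-- Algebra in characteristic 2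

module Char2 {c ℓ} (R : CommutativeSemiring c ℓ) (1+1≈0 : HasChar2 R) where
  open CommutativeSemiring R
  open Exp semiring using (_^_; ^-congˡ)
  open SetoidReasoning setoid

  private
    -- Coefficients of the ring solver. Since they lie in the two-element field, normalization
    -- cancels `x + x`, so identities valid only in characteristic 2 are decided by `refl`.
    𝔽₂ : RawRing 0ℓ 0ℓ
    𝔽₂ = record
      { Carrier = Bool ; _≈_ = _≡_ ; _+_ = _xor_ ; _*_ = _∧_
      ; -_ = λ b → b ; 0# = false ; 1# = true }

    ⟦_⟧ : Bool → Carrier
    ⟦ false ⟧ = 0#
    ⟦ true  ⟧ = 1#

    ⟦⟧-+ : ∀ a b → ⟦ a xor b ⟧ ≈ ⟦ a ⟧ + ⟦ b ⟧
    ⟦⟧-+ false b     = sym (+-identityˡ _)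
    ⟦⟧-+ true  false = sym (+-identityʳ _)
    ⟦⟧-+ true  true  = sym 1+1≈0

    ⟦⟧-* : ∀ a b → ⟦ a ∧ b ⟧ ≈ ⟦ a ⟧ * ⟦ b ⟧
    ⟦⟧-* false b = sym (zeroˡ _)
    ⟦⟧-* true  b = sym (*-identityˡ _)

    embedding : 𝔽₂ -Raw-AlmostCommutative⟶ fromCommutativeSemiring R
    embedding = record
      { ⟦_⟧ = ⟦_⟧ ; +-homo = ⟦⟧-+ ; *-homo = ⟦⟧-* ; -‿homo = λ _ → refl
      ; 0-homo = refl ; 1-homo = refl }

    _≟_ : ∀ a b → Maybe (⟦ a ⟧ ≈ ⟦ b ⟧)
    a ≟ b with a Bool.≟ b
    ... | yes ≡.refl = just refl
    ... | no _       = nothing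

  open RingSolver 𝔽₂ (fromCommutativeSemiring R) embedding _≟_ public
    using (solve; _:=_; _:+_; _:*_; _:^_; _:×_; con)

  x+x≈0 : ∀ x → x + x ≈ 0#
  x+x≈0 = solve 1 (λ x → x :+ x := con false) refl

  sum≈0⇒≈ : ∀ {x y} → x + y ≈ 0# → x ≈ y
  sum≈0⇒≈ {x} {y} x+y≈0 = begin
    x            ≈⟨ solve 2 (λ x y → x := (x :+ y) :+ y) refl x y ⟩
    (x + y) + y  ≈⟨ +-congʳ x+y≈0 ⟩
    0# + y       ≈⟨ +-identityˡ y ⟩
    y            ∎

  ≈⇒sum≈0 : ∀ {x y} → x ≈ y → x + y ≈ 0#
  ≈⇒sum≈0 {y = y} x≈y = trans (+-congʳ x≈y) (x+x≈0 y)

  -- Reduction modulo a relation: an identity that holds only up to a known zero is handed to the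
  -- solver with an explicit multiple `d` of that zero added on the right.
  +-vanish : ∀ {x y} d → d ≈ 0# → x ≈ y + d → x ≈ y
  +-vanish d d≈0 x≈y+d = trans x≈y+d (trans (+-congˡ d≈0) (+-identityʳ _))

  *-vanishʳ : ∀ {x y} → y ≈ 0# → x * y ≈ 0#
  *-vanishʳ y≈0 = trans (*-congˡ y≈0) (zeroʳ _)

  -- The fifth cyclotomic polynomial expresses primitivity. Unlike `z ^ 5 ≈ 1#` it excludes `z ≈ 1#`
  -- in a nontrivial ring, where the sum of five ones is 1.
  Cyclotomic : Carrier → Set ℓ
  Cyclotomic z = 1# + z + z ^ 2 + z ^ 3 + z ^ 4 ≈ 0#

  module _ {z : Carrier} (Φ : Cyclotomic z) where
    1+z⁵≈0 : 1# + z ^ 5 ≈ 0#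
    1+z⁵≈0 = trans (solve 1 (λ z → con true :+ z :^ 5
      := (con true :+ z) :* (con true :+ z :+ z :^ 2 :+ z :^ 3 :+ z :^ 4)) refl z) (*-vanishʳ Φ)

    cyclotomic-^2 : Cyclotomic (z ^ 2)
    cyclotomic-^2 = trans (solve 1 (λ z → con true :+ z :^ 2 :+ (z :^ 2) :^ 2 :+ (z :^ 2) :^ 3 :+ (z :^ 2) :^ 4
      := (con true :+ z :+ z :^ 2 :+ z :^ 3 :+ z :^ 4) :^ 2) refl z) (trans (*-congʳ Φ) (zeroˡ _))

    -- The cofactor is the fifteenth cyclotomic polynomial modulo 2, because Φ₅(t³) = Φ₅(t) Φ₁₅(t).
    -- For the exponents 2 and 4 Frobenius is enough.
    cyclotomic-^3 : Cyclotomic (z ^ 3)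
    cyclotomic-^3 = trans (solve 1 (λ z → con true :+ z :^ 3 :+ (z :^ 3) :^ 2 :+ (z :^ 3) :^ 3 :+ (z :^ 3) :^ 4
      := (con true :+ z :+ z :^ 3 :+ z :^ 4 :+ z :^ 5 :+ z :^ 7 :+ z :^ 8)
         :* (con true :+ z :+ z :^ 2 :+ z :^ 3 :+ z :^ 4)) refl z) (*-vanishʳ Φ)

    cyclotomic-^4 : Cyclotomic (z ^ 4)
    cyclotomic-^4 = trans (solve 1 (λ z → con true :+ z :^ 4 :+ (z :^ 4) :^ 2 :+ (z :^ 4) :^ 3 :+ (z :^ 4) :^ 4
      := (con true :+ z :+ z :^ 2 :+ z :^ 3 :+ z :^ 4) :^ 4) refl z) (trans (*-congʳ Φ) (zeroˡ _))

    private
      -- Pairing the conjugates of `z` and its inverse `z ^ 4` leaves only the Gaussian periods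
      -- `z + z ^ 4` and `z ^ 2 + z ^ 3` as coefficients.
      conjugates : ∀ a b c →
        (a + z * b + z ^ 2 * c) * (a + z ^ 4 * b + (z ^ 4) ^ 2 * c)
        ≈ a * a + b * b + c * c + (z + z ^ 4) * (a * b + b * c) + (z ^ 2 + z ^ 3) * (a * c)
      conjugates a b c = +-vanish _ (*-vanishʳ 1+z⁵≈0) (solve 4 (λ z a b c →
        (a :+ z :* b :+ z :^ 2 :* c) :* (a :+ z :^ 4 :* b :+ (z :^ 4) :^ 2 :* c)
        := (a :* a :+ b :* b :+ c :* c :+ (z :+ z :^ 4) :* (a :* b :+ b :* c) :+ (z :^ 2 :+ z :^ 3) :* (a :* c))
        :+ (b :* b :+ z :* (b :* c) :+ z :^ 3 :* (a :* c) :+ z :^ 4 :* (b :* c)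
            :+ (con true :+ z :^ 5) :* (c :* c)) :* (con true :+ z :^ 5))
        refl z a b c)

      conjugates² : ∀ a b c →
        (a + z ^ 2 * b + (z ^ 2) ^ 2 * c) * (a + z ^ 3 * b + (z ^ 3) ^ 2 * c)
        ≈ a * a + b * b + c * c + (z ^ 2 + z ^ 3) * (a * b + b * c) + (z + z ^ 4) * (a * c)
      conjugates² a b c = +-vanish _ (*-vanishʳ 1+z⁵≈0) (solve 4 (λ z a b c →
        (a :+ z :^ 2 :* b :+ (z :^ 2) :^ 2 :* c) :* (a :+ z :^ 3 :* b :+ (z :^ 3) :^ 2 :* c)
        := (a :* a :+ b :* b :+ c :* c :+ (z :^ 2 :+ z :^ 3) :* (a :* b :+ b :* c) :+ (z :+ z :^ 4) :* (a :* c))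
        :+ (b :* b :+ z :* (a :* c) :+ z :^ 2 :* (b :* c) :+ z :^ 3 :* (b :* c)
            :+ (con true :+ z :^ 5) :* (c :* c)) :* (con true :+ z :^ 5))
        refl z a b c)

    -- z + z⁴ and z² + z³ are the roots of t² + t + 1.
    norm-formula : ∀ a b c →
      (a + b + c) * ((a + z * b + z ^ 2 * c) * (a + z ^ 4 * b + (z ^ 4) ^ 2 * c))
                  * ((a + z ^ 2 * b + (z ^ 2) ^ 2 * c) * (a + z ^ 3 * b + (z ^ 3) ^ 2 * c))
      ≈ a ^ 5 + b ^ 5 + c ^ 5 + a * b * c * (a * c + b ^ 2)
    norm-formula a b c = begin
      _ ≈⟨ *-cong (*-congˡ (trans (conjugates a b c) (+-congˡ (*-congʳ τ′≈1+τ))))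
                  (trans (conjugates² a b c) (+-congʳ (+-congˡ (*-congʳ τ′≈1+τ)))) ⟩
      (a + b + c) * (e + τ * s + (1# + τ) * p) * (e + (1# + τ) * s + τ * p)
        ≈⟨ +-vanish _ (*-vanishʳ 1+τ+τ²≈0) (solve 5 (λ n e s p τ →
             n :* (e :+ τ :* s :+ (con true :+ τ) :* p) :* (e :+ (con true :+ τ) :* s :+ τ :* p)
             := n :* (e :* e :+ e :* s :+ e :* p :+ s :* s :+ s :* p :+ p :* p)
             :+ n :* (s :* s :+ p :* p) :* (con true :+ τ :+ τ :* τ)) refl (a + b + c) e s p τ) ⟩
      (a + b + c) * (e * e + e * s + e * p + s * s + s * p + p * p)
        ≈⟨ solve 3 (λ a b c →
             let e = a :* a :+ b :* b :+ c :* c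
                 s = a :* b :+ b :* c
                 p = a :* c
             in (a :+ b :+ c) :* (e :* e :+ e :* s :+ e :* p :+ s :* s :+ s :* p :+ p :* p)
             := a :^ 5 :+ b :^ 5 :+ c :^ 5 :+ a :* b :* c :* (a :* c :+ b :^ 2)) refl a b c ⟩
      _ ∎
      where
      e = a * a + b * b + c * c
      s = a * b + b * c
      p = a * c
      τ = z + z ^ 4
      τ′≈1+τ : z ^ 2 + z ^ 3 ≈ 1# + τ
      τ′≈1+τ = +-vanish _ Φ (solve 1 (λ z → z :^ 2 :+ z :^ 3
        := con true :+ (z :+ z :^ 4) :+ (con true :+ z :+ z :^ 2 :+ z :^ 3 :+ z :^ 4)) refl z)
      1+τ+τ²≈0 : 1# + τ + τ * τ ≈ 0#
      1+τ+τ²≈0 = trans (solve 1 (λ z → con true :+ (z :+ z :^ 4) :+ (z :+ z :^ 4) :* (z :+ z :^ 4)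
        := (con true :+ z :^ 3 :+ z :^ 4) :* (con true :+ z :+ z :^ 2 :+ z :^ 3 :+ z :^ 4)) refl z) (*-vanishʳ Φ)

    -- This is `norm-formula` with third component 0; the first step only pads the factors with zero
    -- terms to reach that shape.
    norm-1+x : ∀ x →
      (1# + x) * ((1# + z * x) * (1# + z ^ 4 * x)) * ((1# + z ^ 2 * x) * (1# + z ^ 3 * x)) ≈ 1# + x ^ 5
    norm-1+x x = begin
      _ ≈⟨ solve 2 (λ z x → let o = con true ; n = con false in
             (o :+ x) :* ((o :+ z :* x) :* (o :+ z :^ 4 :* x)) :* ((o :+ z :^ 2 :* x) :* (o :+ z :^ 3 :* x))
             := (o :+ x :+ n) :* ((o :+ z :* x :+ z :^ 2 :* n) :* (o :+ z :^ 4 :* x :+ (z :^ 4) :^ 2 :* n))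
                 :* ((o :+ z :^ 2 :* x :+ (z :^ 2) :^ 2 :* n) :* (o :+ z :^ 3 :* x :+ (z :^ 3) :^ 2 :* n))) refl z x ⟩
      _ ≈⟨ norm-formula 1# x 0# ⟩
      _ ≈⟨ solve 1 (λ x → let o = con true ; n = con false in
             o :^ 5 :+ x :^ 5 :+ n :^ 5 :+ o :* x :* n :* (o :* n :+ x :^ 2) := o :+ x :^ 5) refl x ⟩
      1# + x ^ 5 ∎

  -- The letters stand for α, γ, f₂₅, f₅ and X, with `x * g` in the place of β. The two sides differ
  -- by an element of the ideal generated by the hypotheses, and the last two lines exhibit its
  -- cofactors: `a + c` for the norm relation, and a multiple of `g` for `d`.
  discrepancy : ∀ {a c g h x} →
    a * c + (x * g) ^ 2 ≈ 0# → (a ^ 5 + (x * g) ^ 5 + c ^ 5) * g + h ^ 6 ≈ 0# →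
    ((a + x * g + c) * h + (a + x * g + c) ^ 6 + x * h ^ 6) * g
    ≈ (a + x * g + c) * (h * g + h ^ 6 + x ^ 5 * g ^ 6)
  discrepancy {a} {c} {g} {h} {x} p q = +-vanish _
    (trans (+-cong (*-vanishʳ q) (*-vanishʳ p)) (+-identityʳ _))
    (solve 5 (λ a c g h x →
      let f = a :+ x :* g :+ c
          d = a :* c :+ (x :* g) :^ 2
      in (f :* h :+ f :^ 6 :+ x :* h :^ 6) :* g
      := f :* (h :* g :+ h :^ 6 :+ x :^ 5 :* g :^ 6)
      :+ ((a :+ c) :* ((a :^ 5 :+ (x :* g) :^ 5 :+ c :^ 5) :* g :+ h :^ 6)
      :+ (a :^ 4 :+ c :^ 4 :+ (a :^ 2 :+ c :^ 2) :* d) :* g :* d)) refl a c g h x)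

-- Triangular and generalized pentagonal numbers modulo 5

triangular : ℕ → ℕ
triangular zero    = 0
triangular (suc n) = triangular n ℕ.+ suc n

triangular-even : ∀ n → triangular (n ℕ.* 2) ≡ n ℕ.* suc (n ℕ.* 2)
triangular-even zero    = ≡.refl
triangular-even (suc n) = ≡.trans
  (≡.cong (λ t → t ℕ.+ suc (n ℕ.* 2) ℕ.+ suc (suc (n ℕ.* 2))) (triangular-even n)) (lemma n)
  where
  lemma : ∀ n → n ℕ.* suc (n ℕ.* 2) ℕ.+ suc (n ℕ.* 2) ℕ.+ suc (suc (n ℕ.* 2)) ≡ suc n ℕ.* suc (suc n ℕ.* 2)
  lemma = solve-∀

%5-shift : ∀ {m n} k → n ≡ m ℕ.+ k ℕ.* 5 → n % 5 ≡ m % 5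
%5-shift {m} k n≡m+5k = ≡.trans (≡.cong (_% 5) n≡m+5k) ([m+kn]%n≡m%n m k 5)

triangular-period : ∀ n → triangular (5 ℕ.+ n) % 5 ≡ triangular n % 5
triangular-period n = %5-shift (3 ℕ.+ n) (lemma n (triangular n))
  where
  lemma : ∀ n t → t ℕ.+ suc n ℕ.+ (2 ℕ.+ n) ℕ.+ (3 ℕ.+ n) ℕ.+ (4 ℕ.+ n) ℕ.+ (5 ℕ.+ n) ≡ t ℕ.+ (3 ℕ.+ n) ℕ.* 5
  lemma = solve-∀

-- Modulo 5 the triangular numbers cycle through 0, 1, 3, 1, 0.
triangular≢2 : ∀ n → triangular n % 5 ≢ 2
triangular≢2 0 ()
triangular≢2 1 ()
triangular≢2 2 ()
triangular≢2 3 ()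
triangular≢2 4 ()
triangular≢2 (suc (suc (suc (suc (suc n))))) eq = triangular≢2 n (≡.trans (≡.sym (triangular-period n)) eq)

triangular-5n : ∀ r n → triangular (r ℕ.+ n ℕ.* 5) % 5 ≡ triangular r % 5
triangular-5n r zero    = ≡.cong (λ k → triangular k % 5) (ℕ.+-identityʳ r)
triangular-5n r (suc n) = ≡.trans (≡.cong (λ k → triangular k % 5) (lemma r n))
  (≡.trans (triangular-period (r ℕ.+ n ℕ.* 5)) (triangular-5n r n))
  where
  lemma : ∀ r n → r ℕ.+ suc n ℕ.* 5 ≡ 5 ℕ.+ (r ℕ.+ n ℕ.* 5)
  lemma = solve-∀

-- Completing the square, 8T(k) + 1 = (2k + 1)², and for k = 5n + 2 the root is 5(2n + 1); hence
-- 8T(k) + 1 = 25(8T(n) + 1).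
triangular-5n+2 : ∀ n → triangular (2 ℕ.+ n ℕ.* 5) ≡ 3 ℕ.+ 5 ℕ.* (5 ℕ.* triangular n)
triangular-5n+2 zero    = ≡.refl
triangular-5n+2 (suc n) = ≡.trans (five-steps (2 ℕ.+ n ℕ.* 5))
  (≡.trans (≡.cong (ℕ._+ (5 ℕ.* (2 ℕ.+ n ℕ.* 5) ℕ.+ 15)) (triangular-5n+2 n)) (lemma n (triangular n)))
  where
  five-steps : ∀ m → triangular (5 ℕ.+ m) ≡ triangular m ℕ.+ (5 ℕ.* m ℕ.+ 15)
  five-steps m = lemma₅ m (triangular m)
    where
    lemma₅ : ∀ m t → t ℕ.+ suc m ℕ.+ (2 ℕ.+ m) ℕ.+ (3 ℕ.+ m) ℕ.+ (4 ℕ.+ m) ℕ.+ (5 ℕ.+ m) ≡ t ℕ.+ (5 ℕ.* m ℕ.+ 15)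
    lemma₅ = solve-∀
  lemma : ∀ n t → 3 ℕ.+ 5 ℕ.* (5 ℕ.* t) ℕ.+ (5 ℕ.* (2 ℕ.+ n ℕ.* 5) ℕ.+ 15) ≡ 3 ℕ.+ 5 ℕ.* (5 ℕ.* (t ℕ.+ suc n))
  lemma = solve-∀

-- With s = suc m these are s(3s ∓ 1)/2, in the form in which Shanks's identity produces them.
pentagonal⁻ pentagonal⁺ : ℕ → ℕ
pentagonal⁻ m = suc m ℕ.* m ℕ.+ triangular (suc m)
pentagonal⁺ m = suc m ℕ.* suc m ℕ.+ triangular (suc m)

-- For a generalized pentagonal number e, 24e + 1 is a square, so modulo 5 the number 1 - e is 0, 1
-- or 4. The proof checks one period directly.
pentagonal⁻-residue : ∀ m → pentagonal⁻ m % 5 ℕ.≤ 2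
pentagonal⁻-residue 0 = ℕ.≤ᵇ⇒≤ _ _ _
pentagonal⁻-residue 1 = ℕ.≤ᵇ⇒≤ _ _ _
pentagonal⁻-residue 2 = ℕ.≤ᵇ⇒≤ _ _ _
pentagonal⁻-residue 3 = ℕ.≤ᵇ⇒≤ _ _ _
pentagonal⁻-residue 4 = ℕ.≤ᵇ⇒≤ _ _ _
pentagonal⁻-residue (suc (suc (suc (suc (suc m))))) =
  ≡.subst (ℕ._≤ 2) (≡.sym (%5-shift (3 ℕ.* m ℕ.+ 10) (lemma m (triangular (suc m)))))
    (pentagonal⁻-residue m)
  where
  lemma : ∀ m t → (6 ℕ.+ m) ℕ.* (5 ℕ.+ m) ℕ.+ (t ℕ.+ (2 ℕ.+ m) ℕ.+ (3 ℕ.+ m) ℕ.+ (4 ℕ.+ m) ℕ.+ (5 ℕ.+ m) ℕ.+ (6 ℕ.+ m))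
          ≡ suc m ℕ.* m ℕ.+ t ℕ.+ (3 ℕ.* m ℕ.+ 10) ℕ.* 5
  lemma = solve-∀

pentagonal⁺-residue : ∀ m → pentagonal⁺ m % 5 ℕ.≤ 2
pentagonal⁺-residue 0 = ℕ.≤ᵇ⇒≤ _ _ _
pentagonal⁺-residue 1 = ℕ.≤ᵇ⇒≤ _ _ _
pentagonal⁺-residue 2 = ℕ.≤ᵇ⇒≤ _ _ _
pentagonal⁺-residue 3 = ℕ.≤ᵇ⇒≤ _ _ _
pentagonal⁺-residue 4 = ℕ.≤ᵇ⇒≤ _ _ _
pentagonal⁺-residue (suc (suc (suc (suc (suc m))))) =
  ≡.subst (ℕ._≤ 2) (≡.sym (%5-shift (3 ℕ.* m ℕ.+ 11) (lemma m (triangular (suc m)))))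
    (pentagonal⁺-residue m)
  where
  lemma : ∀ m t → (6 ℕ.+ m) ℕ.* (6 ℕ.+ m) ℕ.+ (t ℕ.+ (2 ℕ.+ m) ℕ.+ (3 ℕ.+ m) ℕ.+ (4 ℕ.+ m) ℕ.+ (5 ℕ.+ m) ℕ.+ (6 ℕ.+ m))
          ≡ suc m ℕ.* suc m ℕ.+ t ℕ.+ (3 ℕ.* m ℕ.+ 11) ℕ.* 5
  lemma = solve-∀

residue : ∀ r n → (5 ℕ.* n ℕ.+ r) % 5 ≡ r % 5
residue r n = %5-shift n (lemma r n)
  where
  lemma : ∀ r n → 5 ℕ.* n ℕ.+ r ≡ r ℕ.+ n ℕ.* 5
  lemma = solve-∀

-- Power series

module PowerSeries (K : CommutativeSemiring 0ℓ 0ℓ) where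
  private
    module K = CommutativeSemiring K
    module K-Reasoning = SetoidReasoning K.setoid

  infix  4 _≈_
  infixl 6 _+_
  infixl 7 _*_

  PS : Set
  PS = ℕ → K.Carrier

  -- A record, not a bare pointwise statement, so that `f` and `g` can be recovered by unification.
  record _≈_ (f g : PS) : Set where
    constructor pointwise
    field at : ∀ n → f n K.≈ g n
  open _≈_ public

  tail : PS → PS
  tail f n = f (suc n)

  const : K.Carrier → PS
  const c zero    = c
  const c (suc _) = K.0#

  _+_ : PS → PS → PS
  (f + g) n = f n K.+ g n

  -- The Cauchy product by the splitting `f = f 0 + X * tail f` of the left factor, which makes the
  -- ring laws inductions on the degree.
  _*_ : PS → PS → PS
  (f * g) zero    = f 0 K.* g 0
  (f * g) (suc n) = f 0 K.* g (suc n) K.+ (tail f * g) n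

  0ₛ 1ₛ : PS
  0ₛ _ = K.0#
  1ₛ   = const K.1#

  -- Serves in place of convergence: infinite products are replaced by truncations, one coefficient
  -- at a time.
  *-local : ∀ {f f′ g g′} n → (∀ k → k ℕ.≤ n → f k K.≈ f′ k) →
            (∀ k → k ℕ.≤ n → g k K.≈ g′ k) → (f * g) n K.≈ (f′ * g′) n
  *-local zero    p q = K.*-cong (p 0 z≤n) (q 0 z≤n)
  *-local (suc n) p q = K.+-cong (K.*-cong (p 0 z≤n) (q _ ℕ.≤-refl))
    (*-local n (λ k k≤n → p (suc k) (s≤s k≤n)) (λ k k≤n → q k (ℕ.m≤n⇒m≤1+n k≤n)))

  *-vanishing : ∀ {f g} n → (∀ i j → i ℕ.+ j ≡ n → f i K.≈ K.0# ⊎ g j K.≈ K.0#) →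
                (f * g) n K.≈ K.0#
  *-vanishing {f} {g} n p = helper f n p
    where
    product-vanishes : ∀ {x y} → x K.≈ K.0# ⊎ y K.≈ K.0# → x K.* y K.≈ K.0#
    product-vanishes (inj₁ x≈0) = K.trans (K.*-congʳ x≈0) (K.zeroˡ _)
    product-vanishes (inj₂ y≈0) = K.trans (K.*-congˡ y≈0) (K.zeroʳ _)
    helper : ∀ f n → (∀ i j → i ℕ.+ j ≡ n → f i K.≈ K.0# ⊎ g j K.≈ K.0#) → (f * g) n K.≈ K.0#
    helper f zero    p = product-vanishes (p 0 0 ≡.refl)
    helper f (suc n) p = K.trans
      (K.+-cong (product-vanishes (p 0 (suc n) ≡.refl))
                (helper (tail f) n (λ i j eq → p (suc i) j (≡.cong suc eq))))
      (K.+-identityʳ _)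

  private
    +-interchange : ∀ a b c d → (a K.+ b) K.+ (c K.+ d) K.≈ (a K.+ c) K.+ (b K.+ d)
    +-interchange a b c d = begin
      (a K.+ b) K.+ (c K.+ d)  ≈⟨ K.+-assoc a b _ ⟩
      a K.+ (b K.+ (c K.+ d))  ≈⟨ K.+-congˡ (K.+-assoc b c d) ⟨
      a K.+ ((b K.+ c) K.+ d)  ≈⟨ K.+-congˡ (K.+-congʳ (K.+-comm b c)) ⟩
      a K.+ ((c K.+ b) K.+ d)  ≈⟨ K.+-congˡ (K.+-assoc c b d) ⟩
      a K.+ (c K.+ (b K.+ d))  ≈⟨ K.+-assoc a c _ ⟨
      (a K.+ c) K.+ (b K.+ d)  ∎
      where open K-Reasoning

  *-distribʳ-at : ∀ h f g n → ((f + g) * h) n K.≈ (f * h + g * h) n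
  *-distribʳ-at h f g zero    = K.distribʳ _ _ _
  *-distribʳ-at h f g (suc n) = K.trans
    (K.+-cong (K.distribʳ _ _ _) (*-distribʳ-at h (tail f) (tail g) n))
    (+-interchange _ _ _ _)

  scale-* : ∀ c f g n → ((λ k → c K.* f k) * g) n K.≈ c K.* (f * g) n
  scale-* c f g zero    = K.*-assoc _ _ _
  scale-* c f g (suc n) = K.trans
    (K.+-cong (K.*-assoc _ _ _) (scale-* c (tail f) g n))
    (K.sym (K.distribˡ _ _ _))

  *-assoc-at : ∀ f g h n → ((f * g) * h) n K.≈ (f * (g * h)) n
  *-assoc-at f g h zero    = K.*-assoc _ _ _
  *-assoc-at f g h (suc n) = begin
    f 0 K.* g 0 K.* h (suc n) K.+ (tail (f * g) * h) n
      ≈⟨ K.+-cong (K.*-assoc _ _ _) (*-distribʳ-at h (λ k → f 0 K.* g (suc k)) (tail f * g) n) ⟩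
    f 0 K.* (g 0 K.* h (suc n)) K.+ (((λ k → f 0 K.* g (suc k)) * h) n K.+ (tail f * g * h) n)
      ≈⟨ K.+-congˡ (K.+-cong (scale-* _ _ _ n) (*-assoc-at (tail f) g h n)) ⟩
    f 0 K.* (g 0 K.* h (suc n)) K.+ (f 0 K.* (tail g * h) n K.+ (tail f * (g * h)) n)
      ≈⟨ K.+-assoc _ _ _ ⟨
    f 0 K.* (g 0 K.* h (suc n)) K.+ f 0 K.* (tail g * h) n K.+ (tail f * (g * h)) n
      ≈⟨ K.+-congʳ (K.distribˡ _ _ _) ⟨
    f 0 K.* (g * h) (suc n) K.+ (tail f * (g * h)) n ∎
    where open K-Reasoning

  -- The mirror image of the defining recursion, splitting off the constant term of the right
  -- factor; commutativity compares the two.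
  *-suc-last : ∀ f g n → (f * g) (suc n) K.≈ (f * tail g) n K.+ f (suc n) K.* g 0
  *-suc-last f g zero    = K.refl
  *-suc-last f g (suc n) = K.trans
    (K.+-congˡ (*-suc-last (tail f) g n)) (K.sym (K.+-assoc _ _ _))

  *-comm-at : ∀ f g n → (f * g) n K.≈ (g * f) n
  *-comm-at f g zero    = K.*-comm _ _
  *-comm-at f g (suc n) = begin
    f 0 K.* g (suc n) K.+ (tail f * g) n  ≈⟨ K.+-cong (K.*-comm _ _) (*-comm-at (tail f) g n) ⟩
    g (suc n) K.* f 0 K.+ (g * tail f) n  ≈⟨ K.+-comm _ _ ⟩
    (g * tail f) n K.+ g (suc n) K.* f 0  ≈⟨ *-suc-last g f n ⟨
    (g * f) (suc n)                       ∎
    where open K-Reasoning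

  const-* : ∀ c f n → (const c * f) n K.≈ c K.* f n
  const-* c f zero    = K.refl
  const-* c f (suc n) = K.trans
    (K.+-congˡ (*-vanishing n (λ _ _ _ → inj₁ K.refl))) (K.+-identityʳ _)

  ≈-isEquivalence : IsEquivalence _≈_
  ≈-isEquivalence = record
    { refl  = pointwise (λ _ → K.refl)
    ; sym   = λ p → pointwise (λ n → K.sym (at p n))
    ; trans = λ p q → pointwise (λ n → K.trans (at p n) (at q n)) }

  commutativeSemiring : CommutativeSemiring 0ℓ 0ℓ
  commutativeSemiring = record
    { Carrier = PS ; _≈_ = _≈_ ; _+_ = _+_ ; _*_ = _*_ ; 0# = 0ₛ ; 1# = 1ₛ
    ; isCommutativeSemiring = IsCommutativeSemiringˡ.isCommutativeSemiring record
      { +-isCommutativeMonoid = IsCommutativeMonoidˡ.isCommutativeMonoid record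
        { isSemigroup = record
          { isMagma = record
            { isEquivalence = ≈-isEquivalence
            ; ∙-cong = λ p q → pointwise (λ n → K.+-cong (at p n) (at q n)) }
          ; assoc = λ f g h → pointwise (λ n → K.+-assoc _ _ _) }
        ; identityˡ = λ f → pointwise (λ n → K.+-identityˡ _)
        ; comm      = λ f g → pointwise (λ n → K.+-comm _ _) }
      ; *-isCommutativeMonoid = IsCommutativeMonoidˡ.isCommutativeMonoid record
        { isSemigroup = record
          { isMagma = record
            { isEquivalence = ≈-isEquivalence
            ; ∙-cong = λ p q → pointwise (λ n → *-local n (λ k _ → at p k) (λ k _ → at q k)) }
          ; assoc = λ f g h → pointwise (*-assoc-at f g h) }
        ; identityˡ = λ f → pointwise (λ n → K.trans (const-* _ f n) (K.*-identityˡ _))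
        ; comm      = λ f g → pointwise (*-comm-at f g) }
      ; distribʳ = λ h f g → pointwise (*-distribʳ-at h f g)
      ; zeroˡ    = λ f → pointwise (λ n → *-vanishing n (λ _ _ _ → inj₁ K.refl)) } }

module PowerSeriesChar2 (K : CommutativeSemiring 0ℓ 0ℓ) (1+1≈0 : HasChar2 K) where
  module K = CommutativeSemiring K
  module K₂ = Char2 K 1+1≈0
  module K-Reasoning = SetoidReasoning K.setoid
  open PowerSeries K public
  open CommutativeSemiring commutativeSemiring public
    using (refl; sym; trans; reflexive; setoid; semiring; +-cong; +-congˡ; +-congʳ; *-cong; *-congˡ; *-congʳ;
           +-assoc; *-assoc; *-comm; +-comm; +-identityˡ; +-identityʳ; *-identityˡ; *-identityʳ; zeroʳ; distribˡ)
  open Exp semiring public using (_^_; ^-congˡ; ^-homo-*; ^-assocʳ)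
  module ≈-Reasoning = SetoidReasoning setoid

  hasChar2 : HasChar2 commutativeSemiring
  hasChar2 = pointwise λ { zero → 1+1≈0 ; (suc _) → K.+-identityˡ _ }

  open Char2 commutativeSemiring hasChar2 public

  X : PS
  X zero    = K.0#
  X (suc n) = 1ₛ n

  X*-zero : ∀ f → (X * f) 0 K.≈ K.0#
  X*-zero f = K.zeroˡ _

  X*-suc : ∀ f n → (X * f) (suc n) K.≈ f n
  X*-suc f n = K.trans (K.+-cong (K.zeroˡ _) (at (*-identityˡ f) n)) (K.+-identityˡ _)

  X-cancelˡ : ∀ {f g} → X * f ≈ X * g → f ≈ g
  X-cancelˡ {f} {g} eq = pointwise λ n → K.trans (K.sym (X*-suc f n)) (K.trans (at eq (suc n)) (X*-suc g n))

  tail-X : ∀ {f} → f 0 K.≈ K.0# → X * tail f ≈ f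
  tail-X {f} f0≈0 = pointwise λ { zero → K.trans (X*-zero (tail f)) (K.sym f0≈0) ; (suc n) → X*-suc (tail f) n }

  X^-coeff : ∀ e n → n ≢ e → (X ^ e) n K.≈ K.0#
  X^-coeff zero    zero    n≢e = contradiction ≡.refl n≢e
  X^-coeff zero    (suc n) n≢e = K.refl
  X^-coeff (suc e) zero    n≢e = X*-zero (X ^ e)
  X^-coeff (suc e) (suc n) n≢e = K.trans (X*-suc (X ^ e) n) (X^-coeff e n λ n≡e → n≢e (≡.cong suc n≡e))

  X^*-below : ∀ e f n → n ℕ.< e → (X ^ e * f) n K.≈ K.0#
  X^*-below (suc e) f zero    _         = K.trans (at (*-assoc X (X ^ e) f) 0) (X*-zero (X ^ e * f))
  X^*-below (suc e) f (suc n) (s≤s n<e) = K.trans (at (*-assoc X (X ^ e) f) (suc n))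
    (K.trans (X*-suc (X ^ e * f) n) (X^*-below e f n n<e))

  X^*-above : ∀ e f n → (X ^ e * f) (e ℕ.+ n) K.≈ f n
  X^*-above zero    f n = at (*-identityˡ f) n
  X^*-above (suc e) f n = K.trans (at (*-assoc X (X ^ e) f) (suc (e ℕ.+ n)))
    (K.trans (X*-suc (X ^ e * f) (e ℕ.+ n)) (X^*-above e f n))

  -- Strong induction on the degree: once the lower coefficients of `g` vanish, coefficient n of
  -- `f * g` is `f 0 * g n`. No inverse of `f` has to be constructed.
  cancelˡ : ∀ {f g} → f 0 K.≈ K.1# → f * g ≈ 0ₛ → g ≈ 0ₛ
  cancelˡ {f} {g} f0≈1 fg≈0 = pointwise (<-rec (λ n → g n K.≈ K.0#) step)
    where
    open K-Reasoning
    step : ∀ n → (∀ {k} → k ℕ.< n → g k K.≈ K.0#) → g n K.≈ K.0#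
    step zero    _  = begin
      g 0           ≈⟨ K.*-identityˡ _ ⟨
      K.1# K.* g 0  ≈⟨ K.*-congʳ f0≈1 ⟨
      f 0 K.* g 0   ≈⟨ at fg≈0 0 ⟩
      K.0#          ∎
    step (suc n) ih = begin
      g (suc n)                                 ≈⟨ K.*-identityˡ _ ⟨
      K.1# K.* g (suc n)                        ≈⟨ K.*-congʳ f0≈1 ⟨
      f 0 K.* g (suc n)                         ≈⟨ K.+-identityʳ _ ⟨
      f 0 K.* g (suc n) K.+ K.0#
        ≈⟨ K.+-congˡ (*-vanishing n λ i j i+j≡n → inj₂ (ih (s≤s (≡.subst (j ℕ.≤_) i+j≡n (ℕ.m≤n+m j i))))) ⟨
      f 0 K.* g (suc n) K.+ (tail f * g) n      ≈⟨ at fg≈0 (suc n) ⟩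
      K.0#                                      ∎

  -- The two outer cross terms `f 0 * f (2 + n)` of a square cancel, leaving the square of `tail f`
  -- two degrees lower. Iterating leads to the middle term in even degree and to a cancelling pair
  -- in odd degree.
  square-even : ∀ f n → (f * f) (n ℕ.* 2) K.≈ f n K.* f n
  square-odd  : ∀ f n → (f * f) (suc (n ℕ.* 2)) K.≈ K.0#

  private
    square-step : ∀ f n → (f * f) (2 ℕ.+ n) K.≈ (tail f * tail f) n
    square-step f n = begin
      f 0 K.* f (2 ℕ.+ n) K.+ (tail f * f) (suc n)
        ≈⟨ K.+-congˡ (*-suc-last (tail f) f n) ⟩
      f 0 K.* f (2 ℕ.+ n) K.+ ((tail f * tail f) n K.+ f (2 ℕ.+ n) K.* f 0)
        ≈⟨ K₂.solve 3 (λ a b c → a K₂.:* b K₂.:+ (c K₂.:+ b K₂.:* a) K₂.:= c) K.refl _ _ _ ⟩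
      (tail f * tail f) n ∎
      where open K-Reasoning

  square-even f zero    = K.refl
  square-even f (suc n) = K.trans (square-step f (n ℕ.* 2)) (square-even (tail f) n)
  square-odd f zero     = K.trans (K.+-congˡ (K.*-comm _ _)) (K₂.x+x≈0 _)
  square-odd f (suc n) = K.trans (square-step f (suc (n ℕ.* 2))) (square-odd (tail f) n)

  X-square-even : ∀ f n → (X * (f * f)) (n ℕ.* 2) K.≈ K.0#
  X-square-even f zero    = X*-zero (f * f)
  X-square-even f (suc n) = K.trans (X*-suc (f * f) _) (square-odd f n)

  -- Dilation and residue classes of exponents modulo 5

  -- f(X⁵)
  dilate : PS → PS
  dilate f 0 = f 0
  dilate f 1 = K.0#
  dilate f 2 = K.0#
  dilate f 3 = K.0#
  dilate f 4 = K.0#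
  dilate f (suc (suc (suc (suc (suc n))))) = dilate (tail f) n

  dilate-local : ∀ {f g} n → (∀ k → k ℕ.≤ n → f k K.≈ g k) → dilate f n K.≈ dilate g n
  dilate-local 0 p = p 0 z≤n
  dilate-local 1 p = K.refl
  dilate-local 2 p = K.refl
  dilate-local 3 p = K.refl
  dilate-local 4 p = K.refl
  dilate-local (suc (suc (suc (suc (suc n))))) p =
    dilate-local n λ k k≤n → p (suc k) (s≤s (ℕ.≤-trans k≤n (ℕ.m≤n+m n 4)))

  dilate-cong : ∀ {f g} → f ≈ g → dilate f ≈ dilate g
  dilate-cong f≈g = pointwise λ n → dilate-local n λ k _ → at f≈g k

  dilate-+-at : ∀ f g n → dilate (f + g) n K.≈ (dilate f + dilate g) n
  dilate-+-at f g 0 = K.refl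
  dilate-+-at f g 1 = K.sym (K.+-identityˡ _)
  dilate-+-at f g 2 = K.sym (K.+-identityˡ _)
  dilate-+-at f g 3 = K.sym (K.+-identityˡ _)
  dilate-+-at f g 4 = K.sym (K.+-identityˡ _)
  dilate-+-at f g (suc (suc (suc (suc (suc n))))) = dilate-+-at (tail f) (tail g) n

  dilate-scale : ∀ c f n → dilate (λ k → c K.* f k) n K.≈ c K.* dilate f n
  dilate-scale c f 0 = K.refl
  dilate-scale c f 1 = K.sym (K.zeroʳ _)
  dilate-scale c f 2 = K.sym (K.zeroʳ _)
  dilate-scale c f 3 = K.sym (K.zeroʳ _)
  dilate-scale c f 4 = K.sym (K.zeroʳ _)
  dilate-scale c f (suc (suc (suc (suc (suc n))))) = dilate-scale c (tail f) n

  private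
    x*0+ : ∀ {x y} → y K.≈ K.0# → x K.* K.0# K.+ y K.≈ K.0#
    x*0+ {x} y≈0 = K.trans (K.+-cong (K.zeroʳ x) y≈0) (K.+-identityʳ _)

    0*x+ : ∀ x {y} → K.0# K.* x K.+ y K.≈ y
    0*x+ x = K.trans (K.+-congʳ (K.zeroˡ x)) (K.+-identityˡ _)

  dilate-*-at : ∀ f g n → dilate (f * g) n K.≈ (dilate f * dilate g) n
  dilate-*-at f g 0 = K.refl
  dilate-*-at f g 1 = K.sym (x*0+ (K.zeroˡ _))
  dilate-*-at f g 2 = K.sym (x*0+ (x*0+ (K.zeroˡ _)))
  dilate-*-at f g 3 = K.sym (x*0+ (x*0+ (x*0+ (K.zeroˡ _))))
  dilate-*-at f g 4 = K.sym (x*0+ (x*0+ (x*0+ (x*0+ (K.zeroˡ _)))))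
  dilate-*-at f g (suc (suc (suc (suc (suc n))))) = begin
    dilate (λ k → f 0 K.* g (suc k) K.+ (tail f * g) k) n
      ≈⟨ dilate-+-at (λ k → f 0 K.* g (suc k)) (tail f * g) n ⟩
    dilate (λ k → f 0 K.* g (suc k)) n K.+ dilate (tail f * g) n
      ≈⟨ K.+-cong (dilate-scale (f 0) (tail g) n) (dilate-*-at (tail f) g n) ⟩
    f 0 K.* dilate (tail g) n K.+ (dilate (tail f) * dilate g) n
      ≈⟨ K.+-congˡ (K.trans (0*x+ _) (K.trans (0*x+ _) (K.trans (0*x+ _) (0*x+ _)))) ⟨
    (dilate f * dilate g) (5 ℕ.+ n) ∎
    where open K-Reasoning

  dilate-+ : ∀ f g → dilate (f + g) ≈ dilate f + dilate g
  dilate-+ f g = pointwise (dilate-+-at f g)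

  dilate-* : ∀ f g → dilate (f * g) ≈ dilate f * dilate g
  dilate-* f g = pointwise (dilate-*-at f g)

  dilate-0 : ∀ n → dilate 0ₛ n K.≈ K.0#
  dilate-0 0 = K.refl
  dilate-0 1 = K.refl
  dilate-0 2 = K.refl
  dilate-0 3 = K.refl
  dilate-0 4 = K.refl
  dilate-0 (suc (suc (suc (suc (suc n))))) = dilate-0 n

  dilate-1 : dilate 1ₛ ≈ 1ₛ
  dilate-1 = pointwise λ where
    0 → K.refl
    1 → K.refl
    2 → K.refl
    3 → K.refl
    4 → K.refl
    (suc (suc (suc (suc (suc n))))) → dilate-0 n

  -- Dilation multiplies the order of vanishing by 5, the gain that excludes a lowest term of the
  -- discrepancy.
  dilate-vanishing : ∀ f n → (∀ k → k ℕ.< n → f k K.≈ K.0#) → ∀ k → k ℕ.< 5 ℕ.* n → dilate f k K.≈ K.0#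
  dilate-vanishing f zero    p k ()
  dilate-vanishing f (suc n) p 0 _ = p 0 (s≤s z≤n)
  dilate-vanishing f (suc n) p 1 _ = K.refl
  dilate-vanishing f (suc n) p 2 _ = K.refl
  dilate-vanishing f (suc n) p 3 _ = K.refl
  dilate-vanishing f (suc n) p 4 _ = K.refl
  dilate-vanishing f (suc n) p (suc (suc (suc (suc (suc k))))) k<5n =
    dilate-vanishing (tail f) n (λ j j<n → p (suc j) (s≤s j<n)) k
      (ℕ.+-cancelˡ-< 5 _ _ (≡.subst (5 ℕ.+ k ℕ.<_) (ℕ.*-suc 5 n) k<5n))

  dilate-X : dilate X ≈ X ^ 5
  dilate-X = pointwise λ where
    0 → K.sym (X^-coeff 5 0 λ ())
    1 → K.sym (X^-coeff 5 1 λ ())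
    2 → K.sym (X^-coeff 5 2 λ ())
    3 → K.sym (X^-coeff 5 3 λ ())
    4 → K.sym (X^-coeff 5 4 λ ())
    (suc (suc (suc (suc (suc n))))) → K.trans (at dilate-1 n)
      (K.sym (K.trans (K.sym (at (*-identityʳ (X ^ 5)) (5 ℕ.+ n))) (X^*-above 5 1ₛ n)))

  dilate-^ : ∀ f k → dilate (f ^ k) ≈ dilate f ^ k
  dilate-^ f zero    = dilate-1
  dilate-^ f (suc k) = trans (dilate-* f (f ^ k)) (*-congˡ (dilate-^ f k))

  dilate-X^ : ∀ k → dilate (X ^ k) ≈ X ^ (5 ℕ.* k)
  dilate-X^ k = trans (dilate-^ X k) (trans (^-congˡ k dilate-X) (^-assocʳ X 5 k))

  -- f is a combination of the X ^ n with n % 5 ≡ r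
  Supported : ℕ → PS → Set
  Supported r f = ∀ n → n % 5 ≢ r → f n K.≈ K.0#

  Supported-* : ∀ {r s f g} → Supported r f → Supported s g → Supported ((r ℕ.+ s) % 5) (f * g)
  Supported-* {r} {s} F G n n≢r+s = *-vanishing n split
    where
    split : ∀ i j → i ℕ.+ j ≡ n → _ ⊎ _
    split i j i+j≡n with i % 5 ℕ.≟ r | j % 5 ℕ.≟ s
    ... | no i≢r     | _          = inj₁ (F i i≢r)
    ... | yes _      | no j≢s     = inj₂ (G j j≢s)
    ... | yes ≡.refl | yes ≡.refl =
      contradiction (≡.trans (≡.cong (_% 5) (≡.sym i+j≡n)) (%-distribˡ-+ i j 5)) n≢r+s

  dilate-Supported : ∀ f → Supported 0 (dilate f)
  dilate-Supported f 0 0≢0 = contradiction ≡.refl 0≢0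
  dilate-Supported f 1 _   = K.refl
  dilate-Supported f 2 _   = K.refl
  dilate-Supported f 3 _   = K.refl
  dilate-Supported f 4 _   = K.refl
  dilate-Supported f (suc (suc (suc (suc (suc n))))) n≢0 = dilate-Supported (tail f) n n≢0

  part : ℕ → PS → PS
  part r f n with n % 5 ℕ.≟ r
  ... | yes _ = f n
  ... | no  _ = K.0#

  part-local : ∀ r {f g} n → f n K.≈ g n → part r f n K.≈ part r g n
  part-local r n eq with n % 5 ℕ.≟ r
  ... | yes _ = eq
  ... | no  _ = K.refl

  part-cong : ∀ r {f g} → f ≈ g → part r f ≈ part r g
  part-cong r f≈g = pointwise λ n → part-local r n (at f≈g n)

  part-at : ∀ {r f} n → n % 5 ≡ r → part r f n K.≈ f n
  part-at {r} n n≡r with n % 5 ℕ.≟ r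
  ... | yes _  = K.refl
  ... | no n≢r = contradiction n≡r n≢r

  part-Supported : ∀ r f → Supported r (part r f)
  part-Supported r f n n≢r with n % 5 ℕ.≟ r
  ... | yes n≡r = contradiction n≡r n≢r
  ... | no _    = K.refl

  part-+ : ∀ r f g → part r (f + g) ≈ part r f + part r g
  part-+ r f g = pointwise λ n → helper n
    where
    helper : ∀ n → part r (f + g) n K.≈ (part r f + part r g) n
    helper n with n % 5 ℕ.≟ r
    ... | yes _ = K.refl
    ... | no  _ = K.sym (K.+-identityʳ _)

  part-same : ∀ {r f} → Supported r f → part r f ≈ f
  part-same {r} {f} F = pointwise λ n → helper n
    where
    helper : ∀ n → part r f n K.≈ f n
    helper n with n % 5 ℕ.≟ r
    ... | yes _  = K.refl
    ... | no n≢r = K.sym (F n n≢r)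

  part-other : ∀ {r s f} → Supported s f → r ≢ s → part r f ≈ 0ₛ
  part-other {r} {s} {f} F r≢s = pointwise λ n → helper n
    where
    helper : ∀ n → part r f n K.≈ K.0#
    helper n with n % 5 ℕ.≟ r
    ... | yes n≡r = F n λ n≡s → r≢s (≡.trans (≡.sym n≡r) n≡s)
    ... | no _    = K.refl

  part-0 : ∀ r → part r 0ₛ ≈ 0ₛ
  part-0 r = pointwise helper
    where
    helper : ∀ n → part r 0ₛ n K.≈ K.0#
    helper n with n % 5 ℕ.≟ r
    ... | yes _ = K.refl
    ... | no  _ = K.refl

  Supported-+ : ∀ {r f g} → Supported r f → Supported r g → Supported r (f + g)
  Supported-+ F G n n≢r = K.trans (K.+-cong (F n n≢r) (G n n≢r)) (K.+-identityʳ _)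

  X^-Supported : ∀ e → Supported (e % 5) (X ^ e)
  X^-Supported e n n≢e = X^-coeff e n λ n≡e → n≢e (≡.cong (_% 5) n≡e)

  -- Infinite products and the reductions of the eta factors

  prod : (ℕ → PS) → ℕ → PS
  prod f zero    = 1ₛ
  prod f (suc M) = prod f M * f (suc M)

  ∏∞ : (ℕ → PS) → PS
  ∏∞ f N = prod f N N

  -- the condition under which the truncations of the infinite product stabilise
  Unital : (ℕ → PS) → Set
  Unital f = ∀ n k → k ℕ.< n → f n k K.≈ 1ₛ k

  prod-cong : ∀ {f g} → (∀ n → f (suc n) ≈ g (suc n)) → ∀ M → prod f M ≈ prod g M
  prod-cong f≈g zero    = refl
  prod-cong f≈g (suc M) = *-cong (prod-cong f≈g M) (f≈g M)

  ∏∞-cong : ∀ {f g} → (∀ n → f (suc n) ≈ g (suc n)) → ∏∞ f ≈ ∏∞ g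
  ∏∞-cong f≈g = pointwise λ N → at (prod-cong f≈g N) N

  private
    *-interchange : ∀ a b c d → (a * b) * (c * d) ≈ (a * c) * (b * d)
    *-interchange = solve 4 (λ a b c d → (a :* b) :* (c :* d) := (a :* c) :* (b :* d)) refl

  prod-* : ∀ f g M → prod (λ n → f n * g n) M ≈ prod f M * prod g M
  prod-* f g zero    = sym (*-identityˡ _)
  prod-* f g (suc M) = trans (*-congʳ (prod-* f g M)) (*-interchange _ _ _ _)

  prod-stable : ∀ {f} → Unital f → ∀ {n M} → n ℕ.≤ M → prod f M n K.≈ ∏∞ f n
  prod-stable {f} u n≤M = helper (ℕ.≤⇒≤′ n≤M)
    where
    helper : ∀ {n M} → n ℕ.≤′ M → prod f M n K.≈ ∏∞ f n
    helper (ℕ.≤′-reflexive ≡.refl) = K.refl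
    helper {n} {suc M} (ℕ.≤′-step n≤M) = K.trans
      (*-local {g′ = 1ₛ} n (λ _ _ → K.refl) (λ k k≤n → u (suc M) k (s≤s (ℕ.≤-trans k≤n (ℕ.≤′⇒≤ n≤M)))))
      (K.trans (at (*-identityʳ (prod f M)) n) (helper n≤M))

  ∏∞-* : ∀ {f g} → Unital f → Unital g → ∏∞ (λ n → f n * g n) ≈ ∏∞ f * ∏∞ g
  ∏∞-* {f} {g} u v = pointwise λ N → K.trans (at (prod-* f g N) N)
    (*-local N (λ k k≤N → prod-stable u k≤N) (λ k k≤N → prod-stable v k≤N))

  Unital-1 : Unital (λ _ → 1ₛ)
  Unital-1 _ _ _ = K.refl

  Unital-* : ∀ {f g} → Unital f → Unital g → Unital (λ n → f n * g n)
  Unital-* u v n k k<n = K.trans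
    (*-local {f′ = 1ₛ} {g′ = 1ₛ} k (λ j j≤k → u n j (ℕ.≤-<-trans j≤k k<n)) (λ j j≤k → v n j (ℕ.≤-<-trans j≤k k<n)))
    (at (*-identityˡ 1ₛ) k)

  Unital-^ : ∀ {f} → Unital f → ∀ k → Unital (λ n → f n ^ k)
  Unital-^ u zero    = Unital-1
  Unital-^ u (suc k) = Unital-* u (Unital-^ u k)

  prod-1 : ∀ M → prod (λ _ → 1ₛ) M ≈ 1ₛ
  prod-1 zero    = refl
  prod-1 (suc M) = trans (*-identityʳ _) (prod-1 M)

  ∏∞-1 : ∏∞ (λ _ → 1ₛ) ≈ 1ₛ
  ∏∞-1 = pointwise λ N → at (prod-1 N) N

  ∏∞-^ : ∀ {f} → Unital f → ∀ k → ∏∞ (λ n → f n ^ k) ≈ ∏∞ f ^ k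
  ∏∞-^ u zero    = ∏∞-1
  ∏∞-^ u (suc k) = trans (∏∞-* u (Unital-^ u k)) (*-congˡ (∏∞-^ u k))

  1+X^ : ℕ → PS
  1+X^ m = 1ₛ + X ^ m

  1/1+X^ : ℕ → PS
  1/1+X^ m n = if does (m ∣? n) then K.1# else K.0#

  private
    1/1+X^-multiple : ∀ {m n} → m ℕ.∣ n → 1/1+X^ m n K.≈ K.1#
    1/1+X^-multiple {m} {n} m∣n with m ∣? n
    ... | yes _  = K.refl
    ... | no m∤n = contradiction m∣n m∤n

    1/1+X^-other : ∀ {m n} → m ∤ n → 1/1+X^ m n K.≈ K.0#
    1/1+X^-other {m} {n} m∤n with m ∣? n
    ... | yes m∣n = contradiction m∣n m∤n
    ... | no _    = K.refl

  1/1+X^-below : ∀ {m} k → k ℕ.< m → 1/1+X^ m k K.≈ 1ₛ k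
  1/1+X^-below {m} zero    _   = 1/1+X^-multiple (m ∣0)
  1/1+X^-below (suc k) k<m = 1/1+X^-other (>⇒∤ k<m)

  1/1+X^-periodic : ∀ m k → 1/1+X^ m (m ℕ.+ k) K.≈ 1/1+X^ m k
  1/1+X^-periodic m k with m ∣? k
  ... | yes m∣k = 1/1+X^-multiple (∣m∣n⇒∣m+n ∣-refl m∣k)
  ... | no  m∤k = 1/1+X^-other λ m∣m+k → m∤k (∣m+n∣m⇒∣n m∣m+k ∣-refl)

  1/1+X^-unfold : ∀ m → 1/1+X^ (suc m) ≈ 1ₛ + X ^ suc m * 1/1+X^ (suc m)
  1/1+X^-unfold m = pointwise λ n → split n (n ℕ.<? suc m)
    where
    open K-Reasoning
    g : PS
    g = 1/1+X^ (suc m)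
    split : ∀ n → Dec (n ℕ.< suc m) → g n K.≈ (1ₛ + X ^ suc m * g) n
    split n (yes n<m) = begin
      g n                             ≈⟨ 1/1+X^-below n n<m ⟩
      1ₛ n                            ≈⟨ K.+-identityʳ _ ⟨
      1ₛ n K.+ K.0#                   ≈⟨ K.+-congˡ (X^*-below (suc m) g n n<m) ⟨
      1ₛ n K.+ (X ^ suc m * g) n      ∎
    split n (no n≮m) with ℕ.m≤n⇒∃[o]m+o≡n (ℕ.≮⇒≥ n≮m)
    ... | k , ≡.refl = begin
      g (suc m ℕ.+ k)                                ≈⟨ 1/1+X^-periodic (suc m) k ⟩
      g k                                            ≈⟨ X^*-above (suc m) g k ⟨
      (X ^ suc m * g) (suc m ℕ.+ k)                  ≈⟨ K.+-identityˡ _ ⟨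
      K.0# K.+ (X ^ suc m * g) (suc m ℕ.+ k)         ∎

  1/1+X^-inverse : ∀ m → 1/1+X^ (suc m) * 1+X^ (suc m) ≈ 1ₛ
  1/1+X^-inverse m = begin
    g * (1ₛ + X ^ suc m)          ≈⟨ solve 2 (λ g x → g :* (con true :+ x) := g :+ x :* g) refl g (X ^ suc m) ⟩
    g + X ^ suc m * g             ≈⟨ +-congʳ (1/1+X^-unfold m) ⟩
    (1ₛ + X ^ suc m * g) + X ^ suc m * g  ≈⟨ solve 1 (λ y → (con true :+ y) :+ y := con true) refl (X ^ suc m * g) ⟩
    1ₛ                            ∎
    where
    open ≈-Reasoning
    g = 1/1+X^ (suc m)


  private
    n<d*[1+n] : ∀ d n {k} → k ℕ.< suc n → k ℕ.< suc d ℕ.* suc n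
    n<d*[1+n] d n k<n = ℕ.≤-trans k<n (ℕ.m≤n*m (suc n) (suc d))

  Unital-1+X^ : ∀ d → Unital (λ n → 1+X^ (suc d ℕ.* n))
  Unital-1+X^ d (suc n) k k<n = K.trans
    (K.+-congˡ (X^-coeff (suc d ℕ.* suc n) k (ℕ.<⇒≢ (n<d*[1+n] d n k<n)))) (K.+-identityʳ _)

  Unital-1/1+X^ : ∀ d → Unital (λ n → 1/1+X^ (suc d ℕ.* n))
  Unital-1/1+X^ d (suc n) k k<n = 1/1+X^-below k (n<d*[1+n] d n k<n)

  -- φ d = ∏ (1 + X^(dn)), the reduction of q^(-d/24) η(dτ)
  φ : ℕ → PS
  φ d = ∏∞ (λ n → 1+X^ (d ℕ.* n))

  φ⁻¹ : ℕ → PS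
  φ⁻¹ d = ∏∞ (λ n → 1/1+X^ (d ℕ.* n))

  φ-inverse : ∀ d → φ⁻¹ (suc d) * φ (suc d) ≈ 1ₛ
  φ-inverse d = begin
    φ⁻¹ (suc d) * φ (suc d)  ≈⟨ ∏∞-* (Unital-1/1+X^ d) (Unital-1+X^ d) ⟨
    ∏∞ (λ n → 1/1+X^ (suc d ℕ.* n) * 1+X^ (suc d ℕ.* n))  ≈⟨ ∏∞-cong (λ n → 1/1+X^-inverse (n ℕ.+ d ℕ.* suc n)) ⟩
    ∏∞ (λ _ → 1ₛ)  ≈⟨ ∏∞-1 ⟩
    1ₛ ∎
    where open ≈-Reasoning

  φ-double : ∀ d → φ (suc d ℕ.* 2) ≈ φ (suc d) ^ 2
  φ-double d = trans (∏∞-cong (λ n → factor (suc n))) (∏∞-^ (Unital-1+X^ d) 2)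
    where
    factor : ∀ n → 1+X^ ((suc d ℕ.* 2) ℕ.* n) ≈ 1+X^ (suc d ℕ.* n) ^ 2
    factor n = begin
      1ₛ + X ^ ((suc d ℕ.* 2) ℕ.* n)  ≡⟨ ≡.cong (λ e → 1ₛ + X ^ e) (exponent (suc d) n) ⟩
      1ₛ + X ^ (suc d ℕ.* n ℕ.* 2)  ≈⟨ +-congˡ (^-assocʳ X (suc d ℕ.* n) 2) ⟨
      1ₛ + (X ^ (suc d ℕ.* n)) ^ 2  ≈⟨ solve 1 (λ x → con true :+ x :^ 2 := (con true :+ x) :^ 2) refl (X ^ (suc d ℕ.* n)) ⟩
      1+X^ (suc d ℕ.* n) ^ 2 ∎
      where
      open ≈-Reasoning
      exponent : ∀ d n → (d ℕ.* 2) ℕ.* n ≡ d ℕ.* n ℕ.* 2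
      exponent = solve-∀

  dilate-1+X^ : ∀ m → dilate (1+X^ m) ≈ 1+X^ (5 ℕ.* m)
  dilate-1+X^ m = trans (dilate-+ 1ₛ (X ^ m)) (+-cong dilate-1 (dilate-X^ m))

  dilate-φ : ∀ d → dilate (φ (suc d)) ≈ φ (5 ℕ.* suc d)
  dilate-φ d = pointwise λ N → begin
    dilate (φ (suc d)) N  ≈⟨ dilate-local N (λ k k≤N → prod-stable (Unital-1+X^ d) k≤N) ⟨
    dilate (prod (λ n → 1+X^ (suc d ℕ.* n)) N) N  ≈⟨ at (dilate-prod N) N ⟩
    φ (5 ℕ.* suc d) N ∎
    where
    open K-Reasoning
    dilate-prod : ∀ M → dilate (prod (λ n → 1+X^ (suc d ℕ.* n)) M) ≈ prod (λ n → 1+X^ ((5 ℕ.* suc d) ℕ.* n)) M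
    dilate-prod zero    = dilate-1
    dilate-prod (suc M) = trans (dilate-* _ _) (*-cong (dilate-prod M)
      (trans (dilate-1+X^ (suc d ℕ.* suc M)) (reflexive (≡.cong 1+X^ (≡.sym (ℕ.*-assoc 5 (suc d) (suc M)))))))

  -- Finite sums and the pentagonal and triangular expansions

  ∑ : (ℕ → PS) → ℕ → PS
  ∑ f zero    = 0ₛ
  ∑ f (suc n) = ∑ f n + f n

  ∑-cong : ∀ {f g} → (∀ s → f s ≈ g s) → ∀ n → ∑ f n ≈ ∑ g n
  ∑-cong f≈g zero    = refl
  ∑-cong f≈g (suc n) = +-cong (∑-cong f≈g n) (f≈g n)

  ∑-+ : ∀ f g n → ∑ (λ s → f s + g s) n ≈ ∑ f n + ∑ g n
  ∑-+ f g zero    = sym (+-identityˡ _)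
  ∑-+ f g (suc n) = trans (+-congʳ (∑-+ f g n))
    (solve 4 (λ a b c d → a :+ b :+ (c :+ d) := a :+ c :+ (b :+ d)) refl (∑ f n) (∑ g n) (f n) (g n))

  ∑-telescope : ∀ (g : ℕ → PS) n → ∑ (λ s → g s + g (suc s)) n ≈ g 0 + g n
  ∑-telescope g zero    = sym (x+x≈0 (g 0))
  ∑-telescope g (suc n) = trans (+-congʳ (∑-telescope g n))
    (solve 3 (λ a b c → a :+ b :+ (b :+ c) := a :+ c) refl (g 0) (g n) (g (suc n)))

  ∑-vanishing : ∀ f n k → (∀ s → f s k K.≈ K.0#) → ∑ f n k K.≈ K.0#
  ∑-vanishing f zero    k p = K.refl
  ∑-vanishing f (suc n) k p = K.trans (K.+-cong (∑-vanishing f n k p) (p n)) (K.+-identityʳ _)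

  ∑-first : ∀ f n → ∑ f (suc n) ≈ f 0 + ∑ (λ s → f (suc s)) n
  ∑-first f zero    = +-comm 0ₛ (f 0)
  ∑-first f (suc n) = trans (+-congʳ (∑-first f n)) (+-assoc _ _ _)

  X^-≡ : ∀ {m n} → m ≡ n → X ^ m ≈ X ^ n
  X^-≡ m≡n = reflexive (≡.cong (X ^_) m≡n)

  -- Shanks's proof of the pentagonal number theorem: consecutive sums F m telescope.
  module Pentagonal where
    open ≈-Reasoning

    P Q : ℕ → PS
    P = prod 1+X^
    Q = prod 1/1+X^

    PQ≈1 : ∀ n → P n * Q n ≈ 1ₛ
    PQ≈1 n = begin
      P n * Q n                         ≈⟨ prod-* 1+X^ 1/1+X^ n ⟨
      prod (λ k → 1+X^ k * 1/1+X^ k) n  ≈⟨ prod-cong (λ k → trans (*-comm _ _) (1/1+X^-inverse k)) n ⟩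
      prod (λ _ → 1ₛ) n                 ≈⟨ prod-1 n ⟩
      1ₛ                                ∎

    Q-step : ∀ s → Q (suc s) * 1+X^ (suc s) ≈ Q s
    Q-step s = trans (*-assoc (Q s) _ _) (trans (*-congˡ (1/1+X^-inverse s)) (*-identityʳ (Q s)))

    exponent : ℕ → ℕ → ℕ
    exponent m s = s ℕ.* m ℕ.+ triangular s

    -- For s ≥ 1 the bracket in `Δ` is `Q (s - 1)` by `Q-step`, while at s = 0 the factor `1+X^ 0`
    -- is `1 + 1`, so the lower end of the telescope vanishes without a separate case.
    term Δ : ℕ → ℕ → PS
    term m s = P m * Q s * X ^ exponent m s
    Δ m s    = P m * (Q s * 1+X^ s) * X ^ exponent m s

    F : ℕ → PS
    F m = ∑ (term m) (suc m)

    exponent-suc-m : ∀ m s → X ^ exponent (suc m) s ≈ X ^ exponent m s * X ^ s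
    exponent-suc-m m s = trans (X^-≡ (lemma m s (triangular s))) (^-homo-* X (exponent m s) s)
      where
      lemma : ∀ m s t → s ℕ.* suc m ℕ.+ t ≡ s ℕ.* m ℕ.+ t ℕ.+ s
      lemma = solve-∀

    exponent-suc-s : ∀ m s → X ^ exponent m (suc s) ≈ X ^ exponent m s * X ^ s * X ^ suc m
    exponent-suc-s m s = trans (X^-≡ (lemma m s (triangular s)))
      (trans (^-homo-* X (exponent m s ℕ.+ s) (suc m)) (*-congʳ (^-homo-* X (exponent m s) s)))
      where
      lemma : ∀ m s t → suc s ℕ.* m ℕ.+ (t ℕ.+ suc s) ≡ s ℕ.* m ℕ.+ t ℕ.+ s ℕ.+ suc m
      lemma = solve-∀

    -- The splitting is `1 + (1 + y) x = (1 + x) + x y` with `x = X ^ s` and `y = X ^ suc m`: the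
    -- first summand gives `Δ m s`, the second `Δ m (suc s)`.
    term-step : ∀ m s → term m s + term (suc m) s ≈ Δ m s + Δ m (suc s)
    term-step m s = begin
      p * q * a + p * (1ₛ + y) * q * X ^ exponent (suc m) s
        ≈⟨ +-congˡ (*-congˡ (exponent-suc-m m s)) ⟩
      p * q * a + p * (1ₛ + y) * q * (a * x)
        ≈⟨ solve 5 (λ p q a x y → p :* q :* a :+ p :* (con true :+ y) :* q :* (a :* x)
             := p :* (q :* (con true :+ x)) :* a :+ p :* q :* (a :* x :* y)) refl p q a x y ⟩
      p * (q * (1ₛ + x)) * a + p * q * (a * x * y)
        ≈⟨ +-congˡ (*-cong (*-congˡ (Q-step s)) (exponent-suc-s m s)) ⟨
      Δ m s + Δ m (suc s) ∎
      where
      p = P m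
      q = Q s
      a = X ^ exponent m s
      x = X ^ s
      y = X ^ suc m

    Δ-zero : ∀ m → Δ m 0 ≈ 0ₛ
    Δ-zero m = solve 2 (λ p x → p :* (con true :* (con true :+ con true)) :* x := con false) refl (P m) (X ^ exponent m 0)

    Δ-diag : ∀ m → Δ m (suc m) ≈ X ^ exponent m (suc m)
    Δ-diag m = trans (*-congʳ (trans (*-congˡ (Q-step m)) (PQ≈1 m))) (*-identityˡ _)

    -- The exponents are `pentagonal⁻ m`, from the upper end of the telescope, and `pentagonal⁺ m`,
    -- from the additional last term of `F (suc m)`.
    increment : ℕ → PS
    increment m = X ^ exponent m (suc m) + X ^ exponent (suc m) (suc m)

    F-step : ∀ m → F (suc m) ≈ F m + increment m
    F-step m = begin
      ∑ (term (suc m)) (suc m) + term (suc m) (suc m)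
        ≈⟨ solve 3 (λ a b c → a :+ c := b :+ ((b :+ a) :+ c)) refl _ (F m) _ ⟩
      F m + ((∑ (term m) (suc m) + ∑ (term (suc m)) (suc m)) + term (suc m) (suc m))
        ≈⟨ +-congˡ (+-congʳ (trans (sym (∑-+ (term m) (term (suc m)) (suc m)))
             (trans (∑-cong (term-step m) (suc m)) (∑-telescope (Δ m) (suc m))))) ⟩
      F m + ((Δ m 0 + Δ m (suc m)) + term (suc m) (suc m))
        ≈⟨ +-congˡ (+-cong (trans (+-cong (Δ-zero m) (Δ-diag m)) (+-identityˡ _))
             (trans (*-congʳ (PQ≈1 (suc m))) (*-identityˡ _))) ⟩
      F m + increment m ∎

    F-zero : F 0 ≈ 1ₛ
    F-zero = solve 0 (con false :+ con true :* con true :* con true := con true) refl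

    F≈∑ : ∀ m → F m ≈ 1ₛ + ∑ increment m
    F≈∑ zero    = trans F-zero (sym (+-identityʳ _))
    F≈∑ (suc m) = trans (F-step m) (trans (+-congʳ (F≈∑ m)) (+-assoc _ _ _))

    -- Every term with s ≥ 1 starts in a degree above m, so up to degree m only the term s = 0,
    -- which is `P m`, survives.
    F≈P : ∀ m k → k ℕ.≤ m → F m k K.≈ P m k
    F≈P m k k≤m = K.trans (at (∑-first (term m) m) k) (K.trans
      (K.+-cong (at (solve 1 (λ p → p :* con true :* con true := p) refl (P m)) k)
        (∑-vanishing (λ s → term m (suc s)) m k λ s → K.trans
          (at (*-comm (P m * Q (suc s)) _) k)
          (X^*-below (exponent m (suc s)) (P m * Q (suc s)) k (k<exponent s))))
      (K.+-identityʳ _))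
      where
      k<exponent : ∀ s → k ℕ.< exponent m (suc s)
      k<exponent s = ℕ.≤-<-trans k≤m (ℕ.≤-<-trans (ℕ.m≤m+n m (s ℕ.* m))
        (ℕ.m<m+n _ (ℕ.≤-trans (s≤s z≤n) (ℕ.m≤n+m (suc s) (triangular s)))))

    φ≈∑ : ∀ m k → k ℕ.≤ m → φ 1 k K.≈ (1ₛ + ∑ increment m) k
    φ≈∑ m k k≤m = K.trans (K.sym (prod-stable (Unital-1+X^ 0) k≤m))
      (K.trans (at (prod-cong (λ n → reflexive (≡.cong 1+X^ (ℕ.*-identityˡ (suc n)))) m) k)
      (K.trans (K.sym (F≈P m k k≤m)) (at (F≈∑ m) k)))

  -- Shanks's proof of Gauss's identity f₂²/f₁ = ∑ X^(s(s+1)/2), whose left side is f₁³ in characteristic 2.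
  module Gauss where
    open ≈-Reasoning

    -- Factors of ∏ (1 + X²ⁿ)/(1 + X²ⁿ⁻¹), the quotient form of f₂²/f₁, and their inverses.
    r r′ : ℕ → PS
    r  n = 1+X^ (n ℕ.* 2) * 1/1+X^ (ℕ.pred (n ℕ.* 2))
    r′ n = 1+X^ (ℕ.pred (n ℕ.* 2)) * 1/1+X^ (n ℕ.* 2)

    R R′ : ℕ → PS
    R  = prod r
    R′ = prod r′

    RR′≈1 : ∀ n → R n * R′ n ≈ 1ₛ
    RR′≈1 n = begin
      R n * R′ n                  ≈⟨ prod-* r r′ n ⟨
      prod (λ k → r k * r′ k) n   ≈⟨ prod-cong (λ k → factor (suc (k ℕ.* 2)) (k ℕ.* 2)) n ⟩
      prod (λ _ → 1ₛ) n           ≈⟨ prod-1 n ⟩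
      1ₛ                          ∎
      where
      factor : ∀ i j → (1+X^ (suc i) * 1/1+X^ (suc j)) * (1+X^ (suc j) * 1/1+X^ (suc i)) ≈ 1ₛ
      factor i j = trans
        (solve 4 (λ a b c d → (a :* b) :* (c :* d) := (d :* a) :* (b :* c)) refl _ _ _ _)
        (trans (*-cong (1/1+X^-inverse i) (1/1+X^-inverse j)) (*-identityˡ 1ₛ))

    R′-step : ∀ s → R′ (suc s) * 1+X^ (suc s ℕ.* 2) ≈ R′ s * 1+X^ (suc (s ℕ.* 2))
    R′-step s = trans
      (solve 4 (λ a b c d → (a :* (b :* c)) :* d := (a :* b) :* (c :* d)) refl (R′ s) _ _ _)
      (trans (*-congˡ (1/1+X^-inverse (suc (s ℕ.* 2)))) (*-identityʳ _))

    g : ℕ → PS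
    g n = 1/1+X^ (suc (n ℕ.* 2))

    -- The factor `g n` in `Δ` is the new denominator brought in by `r (suc n)`. As in the
    -- pentagonal case `Δ n 0` contains `1 + 1`.
    term Δ : ℕ → ℕ → PS
    term n s = R n * R′ s * X ^ (s ℕ.* suc (n ℕ.* 2))
    Δ n s    = R n * (R′ s * 1+X^ (s ℕ.* 2)) * X ^ (s ℕ.* suc (n ℕ.* 2)) * g n

    A : ℕ → PS
    A n = ∑ (term n) n

    X^-double : ∀ s → X ^ (s ℕ.* 2) ≈ X ^ s * X ^ s
    X^-double s = trans (sym (^-assocʳ X s 2)) (*-congˡ (*-identityʳ _))

    X^-suc-n : ∀ n s → X ^ (s ℕ.* suc (suc n ℕ.* 2)) ≈ X ^ (s ℕ.* suc (n ℕ.* 2)) * (X ^ s * X ^ s)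
    X^-suc-n n s = trans (X^-≡ (lemma n s))
      (trans (^-homo-* X (s ℕ.* suc (n ℕ.* 2)) (s ℕ.* 2)) (*-congˡ (X^-double s)))
      where
      lemma : ∀ n s → s ℕ.* suc (suc n ℕ.* 2) ≡ s ℕ.* suc (n ℕ.* 2) ℕ.+ s ℕ.* 2
      lemma = solve-∀

    X^-suc-s : ∀ n s → X ^ (suc s ℕ.* suc (n ℕ.* 2)) ≈ X ^ suc (n ℕ.* 2) * X ^ (s ℕ.* suc (n ℕ.* 2))
    X^-suc-s n s = ^-homo-* X (suc (n ℕ.* 2)) (s ℕ.* suc (n ℕ.* 2))

    term-step : ∀ n s → term n s + term (suc n) s ≈ Δ n s + Δ n (suc s)
    term-step n s = begin
      p * q * a + p * ((1ₛ + X * w) * h) * q * X ^ (s ℕ.* suc (suc n ℕ.* 2))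
        ≈⟨ +-cong (*-identityʳ _) (*-congˡ (sym (X^-suc-n n s))) ⟨
      p * q * a * 1ₛ + p * ((1ₛ + X * w) * h) * q * (a * (t * t))
        -- Both terms are brought over the denominator of `h`; the identity behind the next step is
        -- `(1 + w) + (1 + X w) t² = (1 + t²) + w (1 + X t²)`.
        ≈⟨ +-congʳ (*-congˡ (1/1+X^-inverse (n ℕ.* 2))) ⟨
      p * q * a * (h * (1ₛ + w)) + p * ((1ₛ + X * w) * h) * q * (a * (t * t))
        ≈⟨ solve 7 (λ p q a h w t X →
             p :* q :* a :* (h :* (con true :+ w)) :+ p :* ((con true :+ X :* w) :* h) :* q :* (a :* (t :* t))
             := p :* (q :* (con true :+ t :* t)) :* a :* h :+ p :* (q :* (con true :+ X :* (t :* t))) :* (w :* a) :* h)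
             refl p q a h w t X ⟩
      p * (q * (1ₛ + t * t)) * a * h + p * (q * (1ₛ + X * (t * t))) * (w * a) * h
        ≈⟨ +-cong (*-congʳ (*-congʳ (*-congˡ (*-congˡ (+-congˡ (X^-double s))))))
                  (*-congʳ (*-cong (*-congˡ (trans (R′-step s) (*-congˡ (+-congˡ (*-congˡ (X^-double s)))))) (X^-suc-s n s))) ⟨
      Δ n s + Δ n (suc s) ∎
      where
      p = R n
      q = R′ s
      a = X ^ (s ℕ.* suc (n ℕ.* 2))
      h = g n
      w = X ^ suc (n ℕ.* 2)
      t = X ^ s

    Δ-zero : ∀ n → Δ n 0 ≈ 0ₛ
    Δ-zero n = solve 2 (λ p h → p :* (con true :* (con true :+ con true)) :* con true :* h := con false) refl (R n) (g n)

    -- In characteristic 2 the two boundary terms add up to `a * h * (1 + X * t²) ^ 2` times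
    -- `p * q`. One factor cancels `h`, the other separates two consecutive triangular exponents.
    last-terms : ∀ n → Δ n n + term (suc n) n ≈ X ^ triangular (n ℕ.* 2) + X ^ triangular (suc (n ℕ.* 2))
    last-terms n = begin
      p * (q * (1ₛ + X ^ (n ℕ.* 2))) * a * h + p * ((1ₛ + X * w) * h) * q * X ^ (n ℕ.* suc (suc n ℕ.* 2))
        ≈⟨ +-cong refl (*-congˡ (trans (X^-suc-n n n) (*-congˡ (sym (X^-double n))))) ⟩
      p * (q * (1ₛ + t²)) * a * h + p * ((1ₛ + X * (X * t²)) * h) * q * (a * t²)
        ≈⟨ solve 6 (λ p q a h t² X →
             p :* (q :* (con true :+ t²)) :* a :* h :+ p :* ((con true :+ X :* (X :* t²)) :* h) :* q :* (a :* t²)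
             := (p :* q) :* (h :* (con true :+ X :* t²)) :* (a :+ a :* (X :* t²))) refl p q a h t² X ⟩
      (p * q) * (h * (1ₛ + X * t²)) * (a + a * (X * t²))
        ≈⟨ *-congʳ (*-cong (RR′≈1 n) (1/1+X^-inverse (n ℕ.* 2))) ⟩
      1ₛ * 1ₛ * (a + a * w)
        ≈⟨ solve 1 (λ b → con true :* con true :* b := b) refl _ ⟩
      a + a * w
        ≈⟨ +-cong (X^-≡ (triangular-even n))
             (trans (^-homo-* X (triangular (n ℕ.* 2)) (suc (n ℕ.* 2))) (*-congʳ (X^-≡ (triangular-even n)))) ⟨
      X ^ triangular (n ℕ.* 2) + X ^ triangular (suc (n ℕ.* 2)) ∎
      where
      p = R n
      q = R′ n
      a = X ^ (n ℕ.* suc (n ℕ.* 2))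
      h = g n
      w = X ^ suc (n ℕ.* 2)
      t² = X ^ (n ℕ.* 2)

    ψ : ℕ → PS
    ψ = ∑ (λ s → X ^ triangular s)

    A≈ψ : ∀ n → A n ≈ ψ (n ℕ.* 2)
    A≈ψ zero    = refl
    A≈ψ (suc n) = begin
      ∑ (term (suc n)) n + term (suc n) n
        ≈⟨ solve 3 (λ a b c → a :+ c := b :+ ((b :+ a) :+ c)) refl _ (A n) _ ⟩
      A n + ((A n + ∑ (term (suc n)) n) + term (suc n) n)
        ≈⟨ +-congˡ (+-congʳ (trans (sym (∑-+ (term n) (term (suc n)) n))
             (trans (∑-cong (term-step n) n) (∑-telescope (Δ n) n)))) ⟩
      A n + ((Δ n 0 + Δ n n) + term (suc n) n)
        ≈⟨ +-cong (A≈ψ n) (+-congʳ (trans (+-congʳ (Δ-zero n)) (+-identityˡ _))) ⟩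
      ψ (n ℕ.* 2) + (Δ n n + term (suc n) n)
        ≈⟨ +-congˡ (last-terms n) ⟩
      ψ (n ℕ.* 2) + (X ^ triangular (n ℕ.* 2) + X ^ triangular (suc (n ℕ.* 2)))
        ≈⟨ +-assoc _ _ _ ⟨
      ψ (suc n ℕ.* 2) ∎

    A≈R : ∀ n k → k ℕ.≤ n → A (suc n) k K.≈ R (suc n) k
    A≈R n k k≤n = K.trans (at (∑-first (term (suc n)) n) k) (K.trans
      (K.+-cong (at (solve 1 (λ p → p :* con true :* con true := p) refl (R (suc n))) k)
        (∑-vanishing (λ s → term (suc n) (suc s)) n k λ s → K.trans
          (at (*-comm (R (suc n) * R′ (suc s)) _) k)
          (X^*-below (suc s ℕ.* suc (suc n ℕ.* 2)) (R (suc n) * R′ (suc s)) k (k<exponent s))))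
      (K.+-identityʳ _))
      where
      k<exponent : ∀ s → k ℕ.< suc s ℕ.* suc (suc n ℕ.* 2)
      k<exponent s = s≤s (ℕ.≤-trans k≤n (ℕ.≤-trans (ℕ.m≤m*n n 2) (ℕ.≤-trans (ℕ.m≤n+m _ 2) (ℕ.m≤m+n _ _))))

    Unital-r : Unital r
    Unital-r = Unital-* (λ n k k<n → K.trans (K.+-congˡ (X^-coeff _ k (ℕ.<⇒≢ (ℕ.≤-trans k<n (ℕ.m≤m*n n 2))))) (K.+-identityʳ _))
                        (λ { (suc n) k k<n → 1/1+X^-below k (ℕ.≤-trans k<n (s≤s (ℕ.m≤m*n n 2))) })

    -- Among the first 2n factors of f₁, those with odd exponent cancel the denominators of `R n`,
    -- and those with even exponent double its numerators.
    R*φ-finite : ∀ n → R n * prod (λ k → 1+X^ (1 ℕ.* k)) (n ℕ.* 2) ≈ prod (λ k → 1+X^ (2 ℕ.* k) ^ 2) n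
    R*φ-finite zero    = *-identityˡ 1ₛ
    R*φ-finite (suc n) = begin
      R n * (a * h) * (S * 1+X^ (1 ℕ.* suc (n ℕ.* 2)) * 1+X^ (1 ℕ.* (suc n ℕ.* 2)))
        ≈⟨ *-congˡ (*-cong (*-congˡ (reflexive (≡.cong 1+X^ (ℕ.*-identityˡ (suc (n ℕ.* 2))))))
             (reflexive (≡.cong 1+X^ (ℕ.*-identityˡ (suc n ℕ.* 2))))) ⟩
      R n * (a * h) * (S * b * a)
        ≈⟨ solve 5 (λ R S a b h → R :* (a :* h) :* (S :* b :* a) := R :* S :* (h :* b) :* a :^ 2) refl (R n) S a b h ⟩
      R n * S * (h * b) * a ^ 2
        ≈⟨ *-cong (trans (*-cong (R*φ-finite n) (1/1+X^-inverse (n ℕ.* 2))) (*-identityʳ _))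
                  (^-congˡ 2 (reflexive (≡.cong 1+X^ (ℕ.*-comm (suc n) 2)))) ⟩
      prod (λ k → 1+X^ (2 ℕ.* k) ^ 2) (suc n) ∎
      where
      a = 1+X^ (suc n ℕ.* 2)
      b = 1+X^ (suc (n ℕ.* 2))
      h = g n
      S = prod (λ k → 1+X^ (1 ℕ.* k)) (n ℕ.* 2)

    R*φ : ∏∞ r * φ 1 ≈ φ 2 ^ 2
    R*φ = trans
      (pointwise λ N → K.trans
        (K.sym (*-local N (λ k k≤N → prod-stable Unital-r k≤N)
          (λ k k≤N → prod-stable (Unital-1+X^ 0) (ℕ.≤-trans k≤N (ℕ.m≤m*n N 2)))))
        (at (R*φ-finite N) N))
      (∏∞-^ (Unital-1+X^ 1) 2)

    ∏∞r≈φ³ : ∏∞ r ≈ φ 1 ^ 3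
    ∏∞r≈φ³ = begin
      ∏∞ r                       ≈⟨ *-identityʳ _ ⟨
      ∏∞ r * 1ₛ                  ≈⟨ *-congˡ (φ-inverse 0) ⟨
      ∏∞ r * (φ⁻¹ 1 * φ 1)       ≈⟨ solve 3 (λ r u f → r :* (u :* f) := u :* (r :* f)) refl _ _ _ ⟩
      φ⁻¹ 1 * (∏∞ r * φ 1)       ≈⟨ *-congˡ (trans R*φ (^-congˡ 2 (φ-double 0))) ⟩
      φ⁻¹ 1 * (φ 1 ^ 2) ^ 2      ≈⟨ solve 2 (λ u f → u :* (f :^ 2) :^ 2 := (u :* f) :* f :^ 3) refl _ _ ⟩
      (φ⁻¹ 1 * φ 1) * φ 1 ^ 3    ≈⟨ *-congʳ (φ-inverse 0) ⟩
      1ₛ * φ 1 ^ 3               ≈⟨ *-identityˡ _ ⟩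
      φ 1 ^ 3                    ∎

    φ³≈ψ : ∀ n k → k ℕ.≤ n → (φ 1 ^ 3) k K.≈ ψ (suc n ℕ.* 2) k
    φ³≈ψ n k k≤n = K.trans (K.sym (at ∏∞r≈φ³ k)) (K.trans (K.sym (prod-stable Unital-r (ℕ.m≤n⇒m≤1+n k≤n)))
      (K.trans (K.sym (A≈R n k k≤n)) (at (A≈ψ (suc n)) k)))

  -- The 5-dissections of f₁ and f₁³

  f₁ f₅ f₂₅ : PS
  f₁  = φ 1
  f₅  = φ 5
  f₂₅ = φ 25

  f₁-residue : ∀ k → 2 ℕ.< k % 5 → f₁ k K.≈ K.0#
  f₁-residue k 2<k%5 = K.trans (Pentagonal.φ≈∑ k k ℕ.≤-refl) (K.trans
    (K.+-cong (1ₛ-vanishes k 2<k%5) (∑-vanishing Pentagonal.increment k k λ m → K.trans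
      (K.+-cong (X^-vanishes (pentagonal⁻ m) (pentagonal⁻-residue m)) (X^-vanishes (pentagonal⁺ m) (pentagonal⁺-residue m)))
      (K.+-identityʳ _)))
    (K.+-identityʳ _))
    where
    1ₛ-vanishes : ∀ k → 2 ℕ.< k % 5 → 1ₛ k K.≈ K.0#
    1ₛ-vanishes (suc _) _ = K.refl
    X^-vanishes : ∀ e → e % 5 ℕ.≤ 2 → (X ^ e) k K.≈ K.0#
    X^-vanishes e e%5≤2 = X^-coeff e k λ { ≡.refl → ℕ.<⇒≱ 2<k%5 e%5≤2 }

  α β γ : PS
  α = part 0 f₁
  β = part 1 f₁
  γ = part 2 f₁

  dissection₃ : ∀ {f} → (∀ k → 2 ℕ.< k % 5 → f k K.≈ K.0#) → f ≈ part 0 f + part 1 f + part 2 f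
  dissection₃ {f} f-residue = pointwise λ n → coefficient n _ ≡.refl
    where
    open K-Reasoning
    vanishes : ∀ {r s} n → n % 5 ≡ r → r ≢ s → part s f n K.≈ K.0#
    vanishes {s = s} n n≡r r≢s = part-Supported s f n λ n≡s → r≢s (≡.trans (≡.sym n≡r) n≡s)
    coefficient : ∀ n r → n % 5 ≡ r → f n K.≈ (part 0 f + part 1 f + part 2 f) n
    coefficient n 0 n≡0 = K.sym (K.trans
      (K.+-cong (K.+-cong (part-at n n≡0) (vanishes n n≡0 λ ())) (vanishes n n≡0 λ ()))
      (K.trans (K.+-identityʳ _) (K.+-identityʳ _)))
    coefficient n 1 n≡1 = K.sym (K.trans
      (K.+-cong (K.+-cong (vanishes n n≡1 λ ()) (part-at n n≡1)) (vanishes n n≡1 λ ()))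
      (K.trans (K.+-identityʳ _) (K.+-identityˡ _)))
    coefficient n 2 n≡2 = K.sym (K.trans
      (K.+-cong (K.+-cong (vanishes n n≡2 λ ()) (vanishes n n≡2 λ ())) (part-at n n≡2))
      (K.trans (K.+-congʳ (K.+-identityʳ _)) (K.+-identityˡ _)))
    coefficient n (suc (suc (suc r))) n≡3+r = K.trans
      (f-residue n (≡.subst (2 ℕ.<_) (≡.sym n≡3+r) (s≤s (s≤s (s≤s z≤n)))))
      (K.sym (K.trans
        (K.+-cong (K.+-cong (vanishes n n≡3+r λ ()) (vanishes n n≡3+r λ ()))
          (vanishes n n≡3+r λ ()))
        (K.trans (K.+-identityʳ _) (K.+-identityʳ _))))

  f₁-dissection : f₁ ≈ α + β + γ
  f₁-dissection = dissection₃ f₁-residue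

  part-X^-same : ∀ {r} e → e % 5 ≡ r → part r (X ^ e) ≈ X ^ e
  part-X^-same e ≡.refl = part-same (X^-Supported e)

  part-X^-other : ∀ {r} e → e % 5 ≢ r → part r (X ^ e) ≈ 0ₛ
  part-X^-other e e≢r = part-other (X^-Supported e) (λ r≡e → e≢r (≡.sym r≡e))

  open Gauss using (ψ; φ³≈ψ)

  part₂-ψ : ∀ n → part 2 (ψ n) ≈ 0ₛ
  part₂-ψ zero    = part-0 2
  part₂-ψ (suc n) = trans (part-+ 2 (ψ n) (X ^ triangular n))
    (trans (+-cong (part₂-ψ n) (part-X^-other (triangular n) (triangular≢2 n))) (+-identityˡ _))

  part-+-absorb : ∀ {r} f e {x} → e % 5 ≡ x → x ≢ r → part r (f + X ^ e) ≈ part r f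
  part-+-absorb {r} f e ≡.refl e≢r = trans (part-+ r f (X ^ e)) (trans (+-congˡ (part-X^-other e e≢r)) (+-identityʳ _))

  -- In each block of five indices only `2 + n * 5` has a triangular number congruent to 3, and
  -- `triangular-5n+2` turns its monomial into X³ times a monomial in X²⁵, that is, a double
  -- dilation.
  part₃-ψ : ∀ n → part 3 (ψ (n ℕ.* 5)) ≈ X ^ 3 * dilate (dilate (ψ n))
  part₃-ψ zero    = trans (part-0 3)
    (sym (trans (*-congˡ (trans (dilate-cong (pointwise dilate-0)) (pointwise dilate-0))) (zeroʳ _)))
  part₃-ψ (suc n) = begin
    part 3 (ψ (suc n ℕ.* 5))
      ≈⟨ part-+-absorb (ψ (4 ℕ.+ n ℕ.* 5)) (triangular (4 ℕ.+ n ℕ.* 5)) (triangular-5n 4 n) (λ ()) ⟩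
    part 3 (ψ (4 ℕ.+ n ℕ.* 5))
      ≈⟨ part-+-absorb (ψ (3 ℕ.+ n ℕ.* 5)) (triangular (3 ℕ.+ n ℕ.* 5)) (triangular-5n 3 n) (λ ()) ⟩
    part 3 (ψ (3 ℕ.+ n ℕ.* 5))
      ≈⟨ part-+ 3 (ψ (2 ℕ.+ n ℕ.* 5)) _ ⟩
    part 3 (ψ (2 ℕ.+ n ℕ.* 5)) + part 3 (X ^ triangular (2 ℕ.+ n ℕ.* 5))
      ≈⟨ +-cong
           (trans (part-+-absorb (ψ (1 ℕ.+ n ℕ.* 5)) (triangular (1 ℕ.+ n ℕ.* 5)) (triangular-5n 1 n) (λ ()))
           (trans (part-+-absorb (ψ (n ℕ.* 5)) (triangular (n ℕ.* 5)) (triangular-5n 0 n) (λ ())) (part₃-ψ n)))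
           (trans (part-X^-same (triangular (2 ℕ.+ n ℕ.* 5)) (triangular-5n 2 n)) (X^-≡ (triangular-5n+2 n))) ⟩
    X ^ 3 * dilate (dilate (ψ n)) + X ^ (3 ℕ.+ 5 ℕ.* (5 ℕ.* triangular n))
      ≈⟨ +-congˡ (trans (^-homo-* X 3 (5 ℕ.* (5 ℕ.* triangular n)))
           (*-congˡ (sym (trans (dilate-cong (dilate-X^ (triangular n))) (dilate-X^ (5 ℕ.* triangular n)))))) ⟩
    X ^ 3 * dilate (dilate (ψ n)) + X ^ 3 * dilate (dilate (X ^ triangular n))
      ≈⟨ trans (*-congˡ (trans (dilate-cong (dilate-+ (ψ n) (X ^ triangular n))) (dilate-+ _ _))) (distribˡ _ _ _) ⟨
    X ^ 3 * dilate (dilate (ψ (suc n))) ∎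
    where open ≈-Reasoning

  f₁³ : PS
  f₁³ = f₁ ^ 3

  part₂-f₁³ : part 2 f₁³ ≈ 0ₛ
  part₂-f₁³ = pointwise λ N → K.trans
    (part-local 2 {f₁³} {ψ (suc N ℕ.* 2)} N (φ³≈ψ N N ℕ.≤-refl)) (at (part₂-ψ (suc N ℕ.* 2)) N)

  part₃-f₁³ : part 3 f₁³ ≈ X ^ 3 * f₂₅ ^ 3
  part₃-f₁³ = pointwise λ N → K.trans
    -- The truncation is taken at `4 + N * 5` because the resulting number of terms is
    -- `suc N * 2 * 5`. It is a multiple of 5, as `part₃-ψ` requires, and leaves `suc N * 2` terms,
    -- again a length covered by `φ³≈ψ`.
    (K.trans (part-local 3 {f₁³} {ψ (suc (4 ℕ.+ N ℕ.* 5) ℕ.* 2)} N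
      (φ³≈ψ (4 ℕ.+ N ℕ.* 5) N (ℕ.≤-trans (ℕ.m≤m*n N 5) (ℕ.m≤n+m _ 4))))
      (at (part-cong 3 (reflexive (≡.cong ψ (lemma N)))) N))
    (K.trans (at (part₃-ψ (suc N ℕ.* 2)) N)
    (K.trans (*-local N (λ _ _ → K.refl) (λ k k≤N → dilate-local k λ j j≤k → dilate-local j λ i i≤j →
      K.sym (φ³≈ψ N i (ℕ.≤-trans i≤j (ℕ.≤-trans j≤k k≤N)))))
      (at (*-congˡ (trans (dilate-cong (trans (dilate-^ f₁ 3) (^-congˡ 3 (dilate-φ 0))))
        (trans (dilate-^ f₅ 3) (^-congˡ 3 (dilate-φ 4))))) N)))
    where
    lemma : ∀ N → suc (4 ℕ.+ N ℕ.* 5) ℕ.* 2 ≡ suc N ℕ.* 2 ℕ.* 5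
    lemma = solve-∀

  α-Supported : Supported 0 α
  α-Supported = part-Supported 0 f₁
  β-Supported : Supported 1 β
  β-Supported = part-Supported 1 f₁
  γ-Supported : Supported 2 γ
  γ-Supported = part-Supported 2 f₁

  module HomogeneousParts {x₀ x₁ x₂ x₃ x₄} (s₀ : Supported 0 x₀) (s₁ : Supported 1 x₁) (s₂ : Supported 2 x₂)
                          (s₃ : Supported 3 x₃) (s₄ : Supported 4 x₄) where
    part-sum : ∀ r → part r (x₀ + x₁ + x₂ + x₃ + x₄) ≈ part r x₀ + part r x₁ + part r x₂ + part r x₃ + part r x₄
    part-sum r = trans (part-+ r (x₀ + x₁ + x₂ + x₃) x₄) (+-congʳ (trans (part-+ r (x₀ + x₁ + x₂) x₃)
      (+-congʳ (trans (part-+ r (x₀ + x₁) x₂) (+-congʳ (part-+ r x₀ x₁))))))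

    part₂ : part 2 (x₀ + x₁ + x₂ + x₃ + x₄) ≈ x₂
    part₂ = trans (part-sum 2) (trans
      (+-cong (+-cong (+-cong (+-cong (part-other s₀ λ ()) (part-other s₁ λ ())) (part-same s₂))
        (part-other s₃ λ ())) (part-other s₄ λ ()))
      (solve 1 (λ x → con false :+ con false :+ x :+ con false :+ con false := x) refl x₂))

    part₃ : part 3 (x₀ + x₁ + x₂ + x₃ + x₄) ≈ x₃
    part₃ = trans (part-sum 3) (trans
      (+-cong (+-cong (+-cong (+-cong (part-other s₀ λ ()) (part-other s₁ λ ())) (part-other s₂ λ ()))
        (part-same s₃)) (part-other s₄ λ ()))
      (solve 1 (λ x → con false :+ con false :+ con false :+ x :+ con false := x) refl x₃))

  private
    _⊗_ : ∀ {r s f g} → Supported r f → Supported s g → Supported ((r ℕ.+ s) % 5) (f * g)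
    _⊗_ = Supported-*

    module Cube = HomogeneousParts
      (Supported-+ ((α-Supported ⊗ α-Supported) ⊗ α-Supported) ((γ-Supported ⊗ γ-Supported) ⊗ β-Supported))
      (Supported-+ ((γ-Supported ⊗ γ-Supported) ⊗ γ-Supported) ((α-Supported ⊗ α-Supported) ⊗ β-Supported))
      (Supported-+ ((α-Supported ⊗ α-Supported) ⊗ γ-Supported) ((β-Supported ⊗ β-Supported) ⊗ α-Supported))
      ((β-Supported ⊗ β-Supported) ⊗ β-Supported)
      (Supported-+ ((β-Supported ⊗ β-Supported) ⊗ γ-Supported) ((γ-Supported ⊗ γ-Supported) ⊗ α-Supported))

  -- The summands are ordered by residue 0 to 4. The multinomial coefficient 3 becomes 1 and 6
  -- becomes 0, so the product αβγ, of residue 3, disappears and leaves β³ alone in its class.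
  f₁³-dissection : f₁³ ≈ (α * α * α + γ * γ * β) + (γ * γ * γ + α * α * β) + (α * α * γ + β * β * α)
                   + β * β * β + (β * β * γ + γ * γ * α)
  f₁³-dissection = trans (^-congˡ 3 f₁-dissection) (solve 3 (λ α β γ →
    (α :+ β :+ γ) :^ 3 := (α :* α :* α :+ γ :* γ :* β) :+ (γ :* γ :* γ :+ α :* α :* β)
      :+ (α :* α :* γ :+ β :* β :* α) :+ β :* β :* β :+ (β :* β :* γ :+ γ :* γ :* α)) refl α β γ)

  -- The residue-2 part of f₁³ is α(αγ + β²). It vanishes because no triangular number is 2 modulo
  -- 5, and α has constant term 1.
  αγ≈β² : α * γ + β ^ 2 ≈ 0ₛ
  αγ≈β² = cancelˡ {α} K.refl (begin
    α * (α * γ + β ^ 2)          ≈⟨ solve 3 (λ α β γ → α :* (α :* γ :+ β :^ 2) := α :* α :* γ :+ β :* β :* α) refl α β γ ⟩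
    α * α * γ + β * β * α        ≈⟨ Cube.part₂ ⟨
    _                            ≈⟨ part-cong 2 f₁³-dissection ⟨
    part 2 f₁³                   ≈⟨ part₂-f₁³ ⟩
    0ₛ                           ∎)
    where open ≈-Reasoning

  β³≈[Xf₂₅]³ : β ^ 3 ≈ (X * f₂₅) ^ 3
  β³≈[Xf₂₅]³ = begin
    β ^ 3              ≈⟨ solve 1 (λ β → β :^ 3 := β :* β :* β) refl β ⟩
    β * β * β          ≈⟨ Cube.part₃ ⟨
    _                  ≈⟨ part-cong 3 f₁³-dissection ⟨
    part 3 f₁³         ≈⟨ part₃-f₁³ ⟩
    X ^ 3 * f₂₅ ^ 3    ≈⟨ solve 2 (λ x g → x :^ 3 :* g :^ 3 := (x :* g) :^ 3) refl X f₂₅ ⟩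
    (X * f₂₅) ^ 3      ∎
    where open ≈-Reasoning

  -- The cofactor of `f + g` in `f ^ 3 + g ^ 3` has constant term 1 + 1 + 1 = 1 and can be
  -- cancelled. The condition on constant terms rules out a discrepancy by a cube root of unity,
  -- which `𝔽₁₆` contains.
  cube-injective : ∀ {f g} → f 0 K.≈ K.1# → g 0 K.≈ K.1# → f ^ 3 ≈ g ^ 3 → f ≈ g
  cube-injective {f} {g} f0≈1 g0≈1 f³≈g³ = sum≈0⇒≈ (cancelˡ {f * f + f * g + g * g}
    (K.trans (K.+-cong (K.+-cong (K.*-cong f0≈1 f0≈1) (K.*-cong f0≈1 g0≈1)) (K.*-cong g0≈1 g0≈1))
      (K₂.solve 0 (let 1² = K₂.con true K₂.:* K₂.con true in 1² K₂.:+ 1² K₂.:+ 1² K₂.:= K₂.con true) K.refl))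
    (trans (solve 2 (λ f g → (f :* f :+ f :* g :+ g :* g) :* (f :+ g) := f :^ 3 :+ g :^ 3) refl f g) (≈⇒sum≈0 f³≈g³)))

  -- Cube roots are taken after removing the factor X, since `tail β` and f₂₅ have constant term 1.
  β≈Xf₂₅ : β ≈ X * f₂₅
  β≈Xf₂₅ = trans (sym X*β′≈β) (*-congˡ (cube-injective β′0≈1 K.refl
    (X-cancelˡ (X-cancelˡ (X-cancelˡ (trans (pull-out (tail β)) (trans (^-congˡ 3 X*β′≈β) (trans β³≈[Xf₂₅]³ (sym (pull-out f₂₅))))))))))
    where
    X*β′≈β : X * tail β ≈ β
    X*β′≈β = tail-X K.refl
    pull-out : ∀ f → X * (X * (X * f ^ 3)) ≈ (X * f) ^ 3
    pull-out = solve 2 (λ x f → x :* (x :* (x :* f :^ 3)) := (x :* f) :^ 3) refl X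
    β′0≈1 : tail β 0 K.≈ K.1#
    β′0≈1 = K.trans (at (*-identityˡ (1+X^ 1)) 1) (K.trans (K.+-identityˡ _) (X*-suc 1ₛ 0))

  -- Reduction of integer series and eta quotients modulo 2

  open Mult K.semiring using (×-homo-+; ×1-homo-*) renaming (_×_ to _×ᴷ_)

  -- The sign may be dropped because 1 and -1 agree in characteristic 2; the absolute value is also
  -- what integer divisibility refers to.
  reduce : ℤ → K.Carrier
  reduce i = ∣ i ∣ ×ᴷ K.1#

  private
    reduce-⊖ : ∀ m n → reduce (m ℤ.⊖ n) K.≈ m ×ᴷ K.1# K.+ n ×ᴷ K.1#
    reduce-⊖ zero    zero    = K.sym (K.+-identityˡ _)
    reduce-⊖ zero    (suc n) = K.sym (K.+-identityˡ _)
    reduce-⊖ (suc m) zero    = K.sym (K.+-identityʳ _)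
    reduce-⊖ (suc m) (suc n) = begin
      reduce (suc m ℤ.⊖ suc n)                            ≡⟨ ≡.cong reduce (ℤ.[1+m]⊖[1+n]≡m⊖n m n) ⟩
      reduce (m ℤ.⊖ n)                                    ≈⟨ reduce-⊖ m n ⟩
      m ×ᴷ K.1# K.+ n ×ᴷ K.1#
        ≈⟨ K₂.solve 2 (λ a b → a K₂.:+ b K₂.:= (K₂.con true K₂.:+ a) K₂.:+ (K₂.con true K₂.:+ b)) K.refl _ _ ⟩
      suc m ×ᴷ K.1# K.+ suc n ×ᴷ K.1#                     ∎
      where open K-Reasoning

  reduce-+ : ∀ i j → reduce (i ℤ.+ j) K.≈ reduce i K.+ reduce j
  reduce-+ (+ m)    (+ n)    = ×-homo-+ K.1# m n
  reduce-+ (+ m)    -[1+ n ] = reduce-⊖ m (suc n)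
  reduce-+ -[1+ m ] (+ n)    = K.trans (reduce-⊖ n (suc m)) (K.+-comm _ _)
  reduce-+ -[1+ m ] -[1+ n ] = K.trans
    (K.reflexive (≡.cong (λ k → suc k ×ᴷ K.1#) (≡.sym (ℕ.+-suc m n))))
    (×-homo-+ K.1# (suc m) (suc n))

  reduce-* : ∀ i j → reduce (i ℤ.* j) K.≈ reduce i K.* reduce j
  reduce-* i j = K.trans (K.reflexive (≡.cong (_×ᴷ K.1#) (ℤ.abs-* i j))) (×1-homo-* ∣ i ∣ ∣ j ∣)

  reduce-neg : ∀ i → reduce (ℤ.- i) ≡ reduce i
  reduce-neg i = ≡.cong (_×ᴷ K.1#) (ℤ.∣-i∣≡∣i∣ i)

  reduce-even : ¬ K.1# K.≈ K.0# → ∀ i → reduce i K.≈ K.0# → 2 ℕ.∣ ∣ i ∣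
  reduce-even 1≉0 i = even ∣ i ∣
    where
    even : ∀ n → n ×ᴷ K.1# K.≈ K.0# → 2 ℕ.∣ n
    even 0             _   = 2 ℕ.∣0
    even 1             eq  = contradiction (K.trans (K.sym (K.+-identityʳ _)) eq) 1≉0
    even (suc (suc n)) eq  = ℕ.∣m∣n⇒∣m+n ℕ.∣-refl (even n (K.trans
      (K₂.solve 1 (λ a → a K₂.:= K₂.con true K₂.:+ (K₂.con true K₂.:+ a)) K.refl _) eq))

  reduceₛ : Series → PS
  reduceₛ f n = reduce (f n)

  -- `sumTo` grows at the end, whereas `_*_` recurses on the first summand.
  sumTo-first : ∀ h n → sumTo h (suc n) ≡ h 0 ℤ.+ sumTo (λ k → h (suc k)) n
  sumTo-first h zero    = ≡.refl
  sumTo-first h (suc n) = ≡.trans (≡.cong (ℤ._+ h (suc (suc n))) (sumTo-first h n)) (ℤ.+-assoc (h 0) _ _)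

  reduceₛ-⊛ : ∀ f g → reduceₛ (f ⊛ g) ≈ reduceₛ f * reduceₛ g
  reduceₛ-⊛ f g = pointwise (coefficient f)
    where
    coefficient : ∀ f n → reduce ((f ⊛ g) n) K.≈ (reduceₛ f * reduceₛ g) n
    coefficient f zero    = reduce-* (f 0) (g 0)
    coefficient f (suc n) = begin
      reduce ((f ⊛ g) (suc n))
        ≡⟨ ≡.cong reduce (sumTo-first (λ k → f k ℤ.* g (suc n ℕ.∸ k)) n) ⟩
      reduce (f 0 ℤ.* g (suc n) ℤ.+ ((λ k → f (suc k)) ⊛ g) n)
        ≈⟨ reduce-+ (f 0 ℤ.* g (suc n)) _ ⟩
      reduce (f 0 ℤ.* g (suc n)) K.+ reduce (((λ k → f (suc k)) ⊛ g) n)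
        ≈⟨ K.+-cong (reduce-* (f 0) (g (suc n))) (coefficient (λ k → f (suc k)) n) ⟩
      (reduceₛ f * reduceₛ g) (suc n) ∎
      where open K-Reasoning

  reduceₛ-1 : reduceₛ oneS ≈ 1ₛ
  reduceₛ-1 = pointwise λ { zero → K.+-identityʳ _ ; (suc _) → K.refl }

  reduceₛ-powS : ∀ f k → reduceₛ (powS f k) ≈ reduceₛ f ^ k
  reduceₛ-powS f zero    = reduceₛ-1
  reduceₛ-powS f (suc k) = trans (reduceₛ-⊛ (powS f k) f) (trans (*-congʳ (reduceₛ-powS f k)) (*-comm _ _))

  reduceₛ-oneMinus : ∀ m → reduceₛ (oneMinus m) ≈ 1+X^ m
  reduceₛ-oneMinus m = pointwise λ n → K.trans (reduce-+ (if does (n ℕ.≟ 0) then + 1 else + 0) _) (K.+-cong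
    (at reduceₛ-indicator-0 n)
    (K.trans (K.reflexive (reduce-neg (if does (n ℕ.≟ m) then + 1 else + 0))) (indicator n)))
    where
    reduceₛ-indicator-0 : reduceₛ (λ n → if does (n ℕ.≟ 0) then + 1 else + 0) ≈ 1ₛ
    reduceₛ-indicator-0 = pointwise λ { zero → K.+-identityʳ _ ; (suc _) → K.refl }
    indicator : ∀ n → reduce (if does (n ℕ.≟ m) then + 1 else + 0) K.≈ (X ^ m) n
    indicator n = case-on (n ℕ.≟ m)
      where
      case-on : (d : Dec (n ≡ m)) → reduce (if does d then + 1 else + 0) K.≈ (X ^ m) n
      case-on (no n≢m)      = K.sym (X^-coeff m n n≢m)
      case-on (yes ≡.refl)  = K.trans (K.+-identityʳ _) (K.sym (K.trans
        (K.sym (at (*-identityʳ (X ^ n)) n))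
        (K.trans (K.reflexive (≡.cong (X ^ n * 1ₛ) (≡.sym (ℕ.+-identityʳ n)))) (X^*-above n 1ₛ 0))))

  reduceₛ-geom : ∀ m → reduceₛ (geom m) ≈ 1/1+X^ m
  reduceₛ-geom m = pointwise λ n → case-on n (m ℕ.∣? n)
    where
    case-on : ∀ n (d : Dec (m ℕ.∣ n)) → reduce (if does d then + 1 else + 0) K.≈ (if does d then K.1# else K.0#)
    case-on n (yes _) = K.+-identityʳ _
    case-on n (no _)  = K.refl

  reduceₛ-infProd : ∀ f → reduceₛ (infProd f) ≈ ∏∞ (λ n → reduceₛ (f n))
  reduceₛ-infProd f = pointwise λ N → at (finite N) N
    where
    finite : ∀ M → reduceₛ (prodTo f M) ≈ prod (λ n → reduceₛ (f n)) M
    finite zero    = reduceₛ-1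
    finite (suc M) = trans (reduceₛ-⊛ (prodTo f M) (f (suc M))) (*-congʳ (finite M))

  φ^ : ℕ → ℤ → PS
  φ^ d (+ k)    = φ d ^ k
  φ^ d -[1+ k ] = φ⁻¹ d ^ suc k

  reduceₛ-etaFactor : ∀ d r → reduceₛ (infProd (λ n → factorPow (suc d ℕ.* n) r)) ≈ φ^ (suc d) r
  reduceₛ-etaFactor d (+ k) = trans (reduceₛ-infProd _) (trans
    (∏∞-cong λ n → trans (reduceₛ-powS _ k) (^-congˡ k (reduceₛ-oneMinus (suc d ℕ.* suc n))))
    (∏∞-^ (Unital-1+X^ d) k))
  reduceₛ-etaFactor d -[1+ k ] = trans (reduceₛ-infProd _) (trans
    (∏∞-cong λ n → trans (reduceₛ-powS _ (suc k)) (^-congˡ (suc k) (reduceₛ-geom (suc d ℕ.* suc n))))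
    (∏∞-^ (Unital-1/1+X^ d) (suc k)))

  φ-product : List (ℕ × ℤ) → PS
  φ-product []             = 1ₛ
  φ-product ((d , r) ∷ ds) = φ^ d r * φ-product ds

  reduceₛ-etaProd : ∀ ds → All (λ (d , _) → NonZero d) ds → reduceₛ (etaProd ds) ≈ φ-product ds
  reduceₛ-etaProd []                 []         = reduceₛ-1
  reduceₛ-etaProd ((suc d , r) ∷ ds) (_ ∷ ds≢0) =
    trans (reduceₛ-⊛ (infProd (λ n → factorPow (suc d ℕ.* n) r)) (etaProd ds))
      (*-cong (reduceₛ-etaFactor d r) (reduceₛ-etaProd ds ds≢0))

  reduceₛ-P10 : reduceₛ P10 ≈ φ 2 ^ 1 * (φ 5 ^ 5 * (φ⁻¹ 1 ^ 1 * (φ⁻¹ 10 ^ 5 * 1ₛ)))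
  reduceₛ-P10 = reduceₛ-etaProd ((2 , + 1) ∷ (5 , + 5) ∷ (1 , -[1+ 0 ]) ∷ (10 , -[1+ 4 ]) ∷ []) (_ ∷ _ ∷ _ ∷ _ ∷ [])

  reduceₛ-A10 : reduceₛ A10 ≈ φ 1 ^ 4 * (φ 5 ^ 4 * (φ⁻¹ 2 ^ 4 * (φ⁻¹ 10 ^ 4 * 1ₛ)))
  reduceₛ-A10 = reduceₛ-etaProd ((1 , + 4) ∷ (5 , + 4) ∷ (2 , -[1+ 3 ]) ∷ (10 , -[1+ 3 ]) ∷ []) (_ ∷ _ ∷ _ ∷ _ ∷ [])

-- The norm from series in X to series in X⁵ and the identity f₁ f₅ = f₁⁶ + X f₅⁶

module Parity (K : CommutativeSemiring 0ℓ 0ℓ) (1+1≈0 : HasChar2 K)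
              (ζ : CommutativeSemiring.Carrier K) (Φ : Char2.Cyclotomic K 1+1≈0 ζ)
              (1≉0 : ¬ CommutativeSemiring._≈_ K (CommutativeSemiring.1# K) (CommutativeSemiring.0# K)) where
  open PowerSeriesChar2 K 1+1≈0
  private
    module K^ = Exp K.semiring
  open CommutativeExp commutativeSemiring using (^-distrib-*)

  const-cong : ∀ {x y} → x K.≈ y → const x ≈ const y
  const-cong x≈y = pointwise λ { zero → x≈y ; (suc _) → K.refl }

  const-+ : ∀ x y → const (x K.+ y) ≈ const x + const y
  const-+ x y = pointwise λ { zero → K.refl ; (suc _) → K.sym (K.+-identityʳ _) }

  const-*-const : ∀ x y → const (x K.* y) ≈ const x * const y
  const-*-const x y = pointwise λ
    { zero → K.refl ; (suc n) → K.sym (K.trans (const-* x (const y) (suc n)) (K.zeroʳ _)) }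

  const-^ : ∀ x n → const (x K^.^ n) ≈ const x ^ n
  const-^ x zero    = refl
  const-^ x (suc n) = trans (const-*-const x _) (*-congˡ (const-^ x n))

  z : PS
  z = const ζ

  z-cyclotomic : Cyclotomic z
  z-cyclotomic = trans
    (sym (trans (const-+ _ _) (+-cong (trans (const-+ _ _) (+-cong
      (trans (const-+ _ _) (+-cong (const-+ _ _) (const-^ ζ 2))) (const-^ ζ 3))) (const-^ ζ 4))))
    (trans (const-cong Φ) (pointwise λ { zero → K.refl ; (suc _) → K.refl }))

  z⁵≈1 : z ^ 5 ≈ 1ₛ
  z⁵≈1 = sym (sum≈0⇒≈ (1+z⁵≈0 z-cyclotomic))

  -- f(ζⁱX)
  twist : ℕ → PS → PS
  twist i f n = (ζ K^.^ i) K^.^ n K.* f n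

  scaleBy-* : ∀ ξ f g n → ((λ k → ξ K^.^ k K.* f k) * (λ k → ξ K^.^ k K.* g k)) n K.≈ ξ K^.^ n K.* (f * g) n
  scaleBy-* ξ f g zero    = K.trans (K.*-cong (K.*-identityˡ _) (K.*-identityˡ _)) (K.sym (K.*-identityˡ _))
  scaleBy-* ξ f g (suc n) = begin
    K.1# K.* f 0 K.* (ξ K^.^ suc n K.* g (suc n)) K.+ ((λ k → ξ K^.^ suc k K.* f (suc k)) * (λ k → ξ K^.^ k K.* g k)) n
      ≈⟨ K.+-congˡ (*-local n (λ k _ → K.*-assoc ξ (ξ K^.^ k) (f (suc k))) (λ _ _ → K.refl)) ⟩
    K.1# K.* f 0 K.* (ξ K^.^ suc n K.* g (suc n)) K.+ ((λ k → ξ K.* (ξ K^.^ k K.* f (suc k))) * (λ k → ξ K^.^ k K.* g k)) n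
      ≈⟨ K.+-congˡ (K.trans (scale-* ξ _ _ n) (K.*-congˡ (scaleBy-* ξ (tail f) g n))) ⟩
    K.1# K.* f 0 K.* (ξ K^.^ suc n K.* g (suc n)) K.+ ξ K.* (ξ K^.^ n K.* (tail f * g) n)
      ≈⟨ K₂.solve 5 (λ a x y b c → K₂.con true K₂.:* a K₂.:* (x K₂.:* y K₂.:* b) K₂.:+ x K₂.:* (y K₂.:* c)
           K₂.:= x K₂.:* y K₂.:* (a K₂.:* b K₂.:+ c)) K.refl (f 0) ξ (ξ K^.^ n) (g (suc n)) ((tail f * g) n) ⟩
    ξ K^.^ suc n K.* (f * g) (suc n) ∎
    where open K-Reasoning

  twist-* : ∀ i f g → twist i (f * g) ≈ twist i f * twist i g
  twist-* i f g = pointwise λ n → K.sym (scaleBy-* (ζ K^.^ i) f g n)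

  twist-+ : ∀ i f g → twist i (f + g) ≈ twist i f + twist i g
  twist-+ i f g = pointwise λ n → K.distribˡ _ _ _

  twist-1 : ∀ i → twist i 1ₛ ≈ 1ₛ
  twist-1 i = pointwise λ { zero → K.*-identityˡ _ ; (suc n) → K.zeroʳ _ }

  twist-cong : ∀ i {f g} → f ≈ g → twist i f ≈ twist i g
  twist-cong i f≈g = pointwise λ n → K.*-congˡ (at f≈g n)

  twist-X : ∀ i → twist i X ≈ z ^ i * X
  twist-X i = trans (pointwise coefficient) (*-congʳ (const-^ ζ i))
    where
    ξ = ζ K^.^ i
    coefficient : ∀ n → ξ K^.^ n K.* X n K.≈ (const ξ * X) n
    coefficient 0             = K.trans (K.zeroʳ _) (K.sym (K.zeroʳ _))
    coefficient 1             = K.trans (K.*-congʳ (K.*-identityʳ _)) (K.sym (const-* ξ X 1))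
    coefficient (suc (suc n)) = K.trans (K.zeroʳ _) (K.sym (K.trans (const-* ξ X (2 ℕ.+ n)) (K.zeroʳ _)))

  -- With the exponents in this order the conjugates of `1+X^ m` are `1 + w ^ i * X ^ m` for
  -- `w = z ^ m`, the shape of `norm-1+x`.
  twist-X^ : ∀ i m → twist i (X ^ m) ≈ (z ^ m) ^ i * X ^ m
  twist-X^ i m = begin
    twist i (X ^ m)         ≈⟨ twist-^ m ⟩
    twist i X ^ m           ≈⟨ ^-congˡ m (twist-X i) ⟩
    (z ^ i * X) ^ m         ≈⟨ ^-distrib-* (z ^ i) X m ⟩
    (z ^ i) ^ m * X ^ m     ≈⟨ *-congʳ (trans (^-assocʳ z i m) (trans (X^-swap i m) (sym (^-assocʳ z m i)))) ⟩
    (z ^ m) ^ i * X ^ m     ∎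
    where
    open ≈-Reasoning
    twist-^ : ∀ m → twist i (X ^ m) ≈ twist i X ^ m
    twist-^ zero    = twist-1 i
    twist-^ (suc m) = trans (twist-* i X (X ^ m)) (*-congˡ (twist-^ m))
    X^-swap : ∀ i m → z ^ (i ℕ.* m) ≈ z ^ (m ℕ.* i)
    X^-swap i m = reflexive (≡.cong (z ^_) (ℕ.*-comm i m))

  z^-period : ∀ r k → z ^ (r ℕ.+ k ℕ.* 5) ≈ z ^ r
  z^-period r zero    = reflexive (≡.cong (z ^_) (ℕ.+-identityʳ r))
  z^-period r (suc k) = begin
    z ^ (r ℕ.+ suc k ℕ.* 5)        ≈⟨ reflexive (≡.cong (z ^_) (lemma r k)) ⟩
    z ^ (5 ℕ.+ (r ℕ.+ k ℕ.* 5))    ≈⟨ ^-homo-* z 5 (r ℕ.+ k ℕ.* 5) ⟩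
    z ^ 5 * z ^ (r ℕ.+ k ℕ.* 5)    ≈⟨ *-cong z⁵≈1 (z^-period r k) ⟩
    1ₛ * z ^ r                     ≈⟨ *-identityˡ _ ⟩
    z ^ r                          ∎
    where
    open ≈-Reasoning
    lemma : ∀ r k → r ℕ.+ suc k ℕ.* 5 ≡ 5 ℕ.+ (r ℕ.+ k ℕ.* 5)
    lemma = solve-∀

  twist-Supported : ∀ i {r f} → Supported r f → twist i f ≈ (z ^ i) ^ r * f
  twist-Supported i {r} {f} F = trans (pointwise coefficient)
    (*-congʳ (trans (const-^ (ζ K^.^ i) r) (^-congˡ r (const-^ ζ i))))
    where
    ξ = ζ K^.^ i
    powers : ∀ n → n % 5 ≡ r → ξ K^.^ n K.≈ ξ K^.^ r
    powers n ≡.refl = at (begin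
      const (ξ K^.^ n)             ≈⟨ const-^ ξ n ⟩
      const ξ ^ n                  ≈⟨ ^-congˡ n (const-^ ζ i) ⟩
      (z ^ i) ^ n                  ≈⟨ swap n ⟩
      (z ^ n) ^ i                  ≈⟨ ^-congˡ i (trans (reflexive (≡.cong (z ^_) (m≡m%n+[m/n]*n n 5)))
                                      (z^-period (n % 5) (n ℕ./ 5))) ⟩
      (z ^ (n % 5)) ^ i            ≈⟨ swap (n % 5) ⟨
      (z ^ i) ^ (n % 5)            ≈⟨ ^-congˡ (n % 5) (const-^ ζ i) ⟨
      const ξ ^ (n % 5)            ≈⟨ const-^ ξ (n % 5) ⟨
      const (ξ K^.^ (n % 5))       ∎) 0
      where
      open ≈-Reasoning
      swap : ∀ m → (z ^ i) ^ m ≈ (z ^ m) ^ i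
      swap m = trans (^-assocʳ z i m) (trans (reflexive (≡.cong (z ^_) (ℕ.*-comm i m))) (sym (^-assocʳ z m i)))
    coefficient : ∀ n → ξ K^.^ n K.* f n K.≈ (const (ξ K^.^ r) * f) n
    coefficient n with n % 5 ℕ.≟ r
    ... | yes n≡r = K.trans (K.*-congʳ (powers n n≡r)) (K.sym (const-* _ f n))
    ... | no n≢r  = K.trans (vanish _) (K.sym (K.trans (const-* _ f n) (vanish _)))
      where
      vanish : ∀ c → c K.* f n K.≈ K.0#
      vanish c = K.trans (K.*-congˡ (F n n≢r)) (K.zeroʳ c)

  -- The series itself is the conjugate for i = 0; the others are paired as i and 5 - i to match
  -- `norm-formula`.
  norm : PS → PS
  norm f = f * (twist 1 f * twist 4 f) * (twist 2 f * twist 3 f)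

  norm-* : ∀ f g → norm (f * g) ≈ norm f * norm g
  norm-* f g = trans
    (*-cong (*-congˡ (*-cong (twist-* 1 f g) (twist-* 4 f g))) (*-cong (twist-* 2 f g) (twist-* 3 f g)))
    (solve 10 (λ f f₁ f₂ f₃ f₄ g g₁ g₂ g₃ g₄ →
      (f :* g) :* ((f₁ :* g₁) :* (f₄ :* g₄)) :* ((f₂ :* g₂) :* (f₃ :* g₃))
      := (f :* (f₁ :* f₄) :* (f₂ :* f₃)) :* (g :* (g₁ :* g₄) :* (g₂ :* g₃))) refl
      f (twist 1 f) (twist 2 f) (twist 3 f) (twist 4 f) g (twist 1 g) (twist 2 g) (twist 3 g) (twist 4 g))

  norm-1 : norm 1ₛ ≈ 1ₛ
  norm-1 = trans (*-cong (*-congˡ (*-cong (twist-1 1) (twist-1 4))) (*-cong (twist-1 2) (twist-1 3)))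
    (solve 0 (con true :* (con true :* con true) :* (con true :* con true) := con true) refl)

  norm-local : ∀ {f g} n → (∀ k → k ℕ.≤ n → f k K.≈ g k) → norm f n K.≈ norm g n
  norm-local n p = *-local n
    (λ k k≤n → *-local k (λ j j≤k → p j (ℕ.≤-trans j≤k k≤n))
      (λ j j≤k → *-local j (λ i i≤j → K.*-congˡ (p i (ℕ.≤-trans i≤j (ℕ.≤-trans j≤k k≤n))))
                           (λ i i≤j → K.*-congˡ (p i (ℕ.≤-trans i≤j (ℕ.≤-trans j≤k k≤n))))))
    (λ k k≤n → *-local k (λ j j≤k → K.*-congˡ (p j (ℕ.≤-trans j≤k k≤n))) (λ j j≤k → K.*-congˡ (p j (ℕ.≤-trans j≤k k≤n))))

  twist-1+X^ : ∀ i m → twist i (1+X^ m) ≈ 1ₛ + (z ^ m) ^ i * X ^ m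
  twist-1+X^ i m = trans (twist-+ i 1ₛ (X ^ m)) (+-cong (twist-1 i) (twist-X^ i m))

  private
    norm-1+X^-expand : ∀ {w} m → z ^ m ≈ w → norm (1+X^ m) ≈
      (1ₛ + X ^ m) * ((1ₛ + w * X ^ m) * (1ₛ + w ^ 4 * X ^ m)) * ((1ₛ + w ^ 2 * X ^ m) * (1ₛ + w ^ 3 * X ^ m))
    norm-1+X^-expand {w} m z^m≈w = *-cong
      (*-congˡ (*-cong (trans (factor 1) (+-congˡ (*-congʳ (*-identityʳ w)))) (factor 4)))
      (*-cong (factor 2) (factor 3))
      where
      factor : ∀ i → twist i (1+X^ m) ≈ 1ₛ + w ^ i * X ^ m
      factor i = trans (twist-1+X^ i m) (+-congˡ (*-congʳ (^-congˡ i z^m≈w)))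

  -- If `w` is still primitive, its powers run through all fifth roots of unity. In the
  -- complementary case `z ^ m ≈ 1` all five conjugates coincide, which gives a fifth power.
  norm-1+X^-coprime : ∀ {w} m → z ^ m ≈ w → Cyclotomic w → norm (1+X^ m) ≈ 1+X^ (5 ℕ.* m)
  norm-1+X^-coprime {w} m z^m≈w w-cyclotomic = trans (norm-1+X^-expand m z^m≈w)
    (trans (norm-1+x w-cyclotomic (X ^ m)) (+-congˡ (trans (^-assocʳ X m 5) (X^-≡ (ℕ.*-comm m 5)))))

  norm-1+X^-multiple : ∀ m → z ^ m ≈ 1ₛ → norm (1+X^ m) ≈ 1+X^ m ^ 5
  norm-1+X^-multiple m z^m≈1 = trans (norm-1+X^-expand m z^m≈1)
    (solve 1 (λ x → (con true :+ x) :* ((con true :+ con true :* x) :* (con true :+ con true :^ 4 :* x))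
      :* ((con true :+ con true :^ 2 :* x) :* (con true :+ con true :^ 3 :* x)) := (con true :+ x) :^ 5) refl (X ^ m))

  -- Exponents prime to 5 yield the factors of f₅ whose index is prime to 5, and the product over
  -- 25n supplies the missing ones. Multiples of 5 yield fifth powers, hence f₅⁵. Truncation at
  -- `M * 5` keeps the residue blocks complete.
  norm-prod : ∀ M →
    norm (prod (λ n → 1+X^ (1 ℕ.* n)) (M ℕ.* 5)) * prod (λ n → 1+X^ (25 ℕ.* n)) M
    ≈ prod (λ n → 1+X^ (5 ℕ.* n)) (M ℕ.* 5) * prod (λ n → 1+X^ (5 ℕ.* n) ^ 5) M
  norm-prod zero    = *-congʳ norm-1
  norm-prod (suc M) = begin
    norm (F₀ * e 1 * e 2 * e 3 * e 4 * e 5) * (G * g)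
      ≈⟨ *-congʳ (trans (norm-* _ (e 5)) (*-congʳ (trans (norm-* _ (e 4)) (*-congʳ (trans (norm-* _ (e 3))
           (*-congʳ (trans (norm-* _ (e 2)) (*-congʳ (norm-* F₀ (e 1)))))))))) ⟩
    norm F₀ * norm (e 1) * norm (e 2) * norm (e 3) * norm (e 4) * norm (e 5) * (G * g)
      ≈⟨ *-congʳ (*-cong (*-cong (*-cong (*-cong (*-congˡ
           (coprime 1 (^-congˡ′ (*-identityʳ z) z-cyclotomic)))
           (coprime 2 (cyclotomic-^2 z-cyclotomic)))
           (coprime 3 (cyclotomic-^3 z-cyclotomic)))
           (coprime 4 (cyclotomic-^4 z-cyclotomic)))
           multiple) ⟩
    norm F₀ * d 1 * d 2 * d 3 * d 4 * h * (G * g)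
      ≈⟨ solve 8 (λ n a b c d h G g → n :* a :* b :* c :* d :* h :* (G :* g) := (n :* G) :* (a :* b :* c :* d :* g :* h))
           refl (norm F₀) (d 1) (d 2) (d 3) (d 4) h G g ⟩
    (norm F₀ * G) * (d 1 * d 2 * d 3 * d 4 * g * h)
      ≈⟨ *-cong (norm-prod M) (*-congʳ (*-congˡ (reflexive (≡.cong 1+X^ (lemma M))))) ⟩
    (D * H) * (d 1 * d 2 * d 3 * d 4 * d 5 * h)
      ≈⟨ solve 8 (λ D H a b c d e h → (D :* H) :* (a :* b :* c :* d :* e :* h) := (D :* a :* b :* c :* d :* e) :* (H :* h))
           refl D H (d 1) (d 2) (d 3) (d 4) (d 5) h ⟩
    (D * d 1 * d 2 * d 3 * d 4 * d 5) * (H * h) ∎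
    where
    open ≈-Reasoning
    F₀ = prod (λ n → 1+X^ (1 ℕ.* n)) (M ℕ.* 5)
    G  = prod (λ n → 1+X^ (25 ℕ.* n)) M
    D  = prod (λ n → 1+X^ (5 ℕ.* n)) (M ℕ.* 5)
    H  = prod (λ n → 1+X^ (5 ℕ.* n) ^ 5) M
    g  = 1+X^ (25 ℕ.* suc M)
    h  = 1+X^ (5 ℕ.* suc M) ^ 5
    e d : ℕ → PS
    e r = 1+X^ (1 ℕ.* (r ℕ.+ M ℕ.* 5))
    d r = 1+X^ (5 ℕ.* (r ℕ.+ M ℕ.* 5))
    ^-congˡ′ : ∀ {w w′} → w′ ≈ w → Cyclotomic w → Cyclotomic w′
    ^-congˡ′ w′≈w c = trans (+-cong (+-cong (+-cong (+-congˡ w′≈w) (^-congˡ 2 w′≈w)) (^-congˡ 3 w′≈w)) (^-congˡ 4 w′≈w)) c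
    drop-1* : ∀ m → 1+X^ (1 ℕ.* m) ≡ 1+X^ m
    drop-1* m = ≡.cong 1+X^ (ℕ.*-identityˡ m)
    coprime : ∀ r → Cyclotomic (z ^ r) → norm (e r) ≈ d r
    coprime r c = trans (reflexive (≡.cong norm (drop-1* (r ℕ.+ M ℕ.* 5)))) (norm-1+X^-coprime (r ℕ.+ M ℕ.* 5) (z^-period r M) c)
    multiple : norm (e 5) ≈ h
    multiple = trans (reflexive (≡.cong norm (≡.trans (drop-1* (5 ℕ.+ M ℕ.* 5)) (≡.cong 1+X^ (ℕ.*-comm (suc M) 5)))))
      (norm-1+X^-multiple (5 ℕ.* suc M) (trans (reflexive (≡.cong (z ^_) (ℕ.*-comm 5 (suc M)))) (z^-period 0 (suc M))))
    lemma : ∀ M → 25 ℕ.* suc M ≡ 5 ℕ.* (5 ℕ.+ M ℕ.* 5)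
    lemma = solve-∀

  norm-f₁ : norm f₁ * f₂₅ ≈ f₅ ^ 6
  norm-f₁ = pointwise λ N → begin
    (norm f₁ * f₂₅) N
      ≈⟨ *-local N (λ k k≤N → norm-local {prod (λ n → 1+X^ (1 ℕ.* n)) (N ℕ.* 5)} {f₁} k
                     λ j j≤k → prod-stable (Unital-1+X^ 0) (ℕ.≤-trans j≤k (ℕ.≤-trans k≤N (ℕ.m≤m*n N 5))))
                   (λ k k≤N → prod-stable (Unital-1+X^ 24) k≤N) ⟨
    (norm (prod (λ n → 1+X^ (1 ℕ.* n)) (N ℕ.* 5)) * prod (λ n → 1+X^ (25 ℕ.* n)) N) N
      ≈⟨ at (norm-prod N) N ⟩
    (prod (λ n → 1+X^ (5 ℕ.* n)) (N ℕ.* 5) * prod (λ n → 1+X^ (5 ℕ.* n) ^ 5) N) N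
      ≈⟨ *-local N (λ k k≤N → prod-stable (Unital-1+X^ 4) (ℕ.≤-trans k≤N (ℕ.m≤m*n N 5)))
                   (λ k k≤N → K.trans (prod-stable (Unital-^ (Unital-1+X^ 4) 5) k≤N) (at (∏∞-^ (Unital-1+X^ 4) 5) k)) ⟩
    (f₅ ^ 6) N ∎
    where open K-Reasoning

  norm-dissection : norm f₁ ≈ α ^ 5 + β ^ 5 + γ ^ 5
  norm-dissection = begin
    norm f₁
      ≈⟨ *-cong (*-cong f₁-dissection (*-cong (trans (conjugate 1) (+-cong (+-congˡ (*-congʳ (*-identityʳ z)))
           (*-congʳ (^-congˡ 2 (*-identityʳ z))))) (conjugate 4))) (*-cong (conjugate 2) (conjugate 3)) ⟩
    _ ≈⟨ norm-formula z-cyclotomic α β γ ⟩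
    α ^ 5 + β ^ 5 + γ ^ 5 + α * β * γ * (α * γ + β ^ 2)
      ≈⟨ trans (+-congˡ (*-vanishʳ αγ≈β²)) (+-identityʳ _) ⟩
    α ^ 5 + β ^ 5 + γ ^ 5 ∎
    where
    open ≈-Reasoning
    conjugate : ∀ i → twist i f₁ ≈ α + z ^ i * β + (z ^ i) ^ 2 * γ
    conjugate i = trans (twist-cong i f₁-dissection) (trans (twist-+ i (α + β) γ) (+-cong
      (trans (twist-+ i α β) (+-cong
        (trans (twist-Supported i α-Supported) (*-identityˡ α))
        (trans (twist-Supported i β-Supported) (*-congʳ (*-identityʳ _)))))
      (twist-Supported i γ-Supported)))

  discrepancy₁ : PS
  discrepancy₁ = f₁ * f₅ + f₁ ^ 6 + X * f₅ ^ 6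

  dilate-discrepancy₁ : dilate discrepancy₁ ≈ f₅ * f₂₅ + f₅ ^ 6 + X ^ 5 * f₂₅ ^ 6
  dilate-discrepancy₁ = trans (dilate-+ _ _) (+-cong
    (trans (dilate-+ _ _) (+-cong
      (trans (dilate-* f₁ f₅) (*-cong (dilate-φ 0) (dilate-φ 4)))
      (trans (dilate-^ f₁ 6) (^-congˡ 6 (dilate-φ 0)))))
    (trans (dilate-* X (f₅ ^ 6)) (*-cong dilate-X (trans (dilate-^ f₅ 6) (^-congˡ 6 (dilate-φ 4))))))

  discrepancy-equation : discrepancy₁ * f₂₅ ≈ f₁ * dilate discrepancy₁
  discrepancy-equation = begin
    discrepancy₁ * f₂₅
      ≈⟨ *-congʳ (+-congʳ (+-cong (*-congʳ f₁≈) (^-congˡ 6 f₁≈))) ⟩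
    ((α + X * f₂₅ + γ) * f₅ + (α + X * f₂₅ + γ) ^ 6 + X * f₅ ^ 6) * f₂₅
      ≈⟨ discrepancy {α} {γ} {f₂₅} {f₅} {X}
           (trans (+-congˡ (^-congˡ 2 (sym β≈Xf₂₅))) αγ≈β²)
           (≈⇒sum≈0 (trans (*-congʳ (trans (+-congʳ (+-congˡ (^-congˡ 5 (sym β≈Xf₂₅)))) (sym norm-dissection))) norm-f₁)) ⟩
    (α + X * f₂₅ + γ) * (f₅ * f₂₅ + f₅ ^ 6 + X ^ 5 * f₂₅ ^ 6)
      ≈⟨ *-cong f₁≈ dilate-discrepancy₁ ⟨
    f₁ * dilate discrepancy₁ ∎
    where
    open ≈-Reasoning
    f₁≈ : f₁ ≈ α + X * f₂₅ + γ
    f₁≈ = trans f₁-dissection (+-congʳ (+-congˡ β≈Xf₂₅))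

  -- The lowest term of d = discrepancy₁ cannot survive in d(X) f₁(X²⁵) = f₁(X) d(X⁵).
  discrepancy₁≈0 : discrepancy₁ ≈ 0ₛ
  discrepancy₁≈0 = pointwise (<-rec _ step)
    where
    open K-Reasoning
    d = discrepancy₁
    step : ∀ n → (∀ {k} → k ℕ.< n → d k K.≈ K.0#) → d n K.≈ K.0#
    step zero    _  = K₂.solve 0 (let
        1′ = K₂.con true
        1⁶ = 1′ K₂.:* (1′ K₂.:* (1′ K₂.:* (1′ K₂.:* (1′ K₂.:* (1′ K₂.:* 1′)))))
      in 1′ K₂.:* 1′ K₂.:+ 1⁶ K₂.:+ K₂.con false K₂.:* 1⁶ K₂.:= K₂.con false) K.refl
    step (suc n) ih = begin
      d (suc n)                                        ≈⟨ K.*-identityˡ _ ⟨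
      f₂₅ 0 K.* d (suc n)                              ≈⟨ K.+-identityʳ _ ⟨
      f₂₅ 0 K.* d (suc n) K.+ K.0#
        ≈⟨ K.+-congˡ (*-vanishing n λ i j i+j≡n → inj₂ (ih (s≤s (≡.subst (j ℕ.≤_) i+j≡n (ℕ.m≤n+m j i))))) ⟨
      (f₂₅ * d) (suc n)                                ≈⟨ at (*-comm f₂₅ d) (suc n) ⟩
      (d * f₂₅) (suc n)                                ≈⟨ at discrepancy-equation (suc n) ⟩
      (f₁ * dilate d) (suc n)
        ≈⟨ *-vanishing {f₁} {dilate d} (suc n) (λ i j i+j≡n → inj₂ (dilate-vanishing d (suc n) (λ _ → ih) j
             (ℕ.≤-<-trans (≡.subst (j ℕ.≤_) i+j≡n (ℕ.m≤n+m j i)) (ℕ.m<m+n (suc n) (s≤s z≤n))))) ⟩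
      K.0# ∎

  f₁f₅ : f₁ * f₅ ≈ f₁ ^ 6 + X * f₅ ^ 6
  f₁f₅ = sum≈0⇒≈ (trans (sym (+-assoc _ _ _)) discrepancy₁≈0)

  -- Square dissections of the eta quotients and the vanishing coefficients

  inverse-unique : ∀ {f g h} → f * h ≈ 1ₛ → g * h ≈ 1ₛ → f ≈ g
  inverse-unique {f} {g} {h} fh≈1 gh≈1 = begin
    f              ≈⟨ *-identityʳ f ⟨
    f * 1ₛ         ≈⟨ *-congˡ gh≈1 ⟨
    f * (g * h)    ≈⟨ solve 3 (λ f g h → f :* (g :* h) := (f :* h) :* g) refl f g h ⟩
    (f * h) * g    ≈⟨ *-congʳ fh≈1 ⟩
    1ₛ * g         ≈⟨ *-identityˡ g ⟩
    g              ∎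
    where open ≈-Reasoning

  -- Defining the inverse of f₅ as a dilation makes its support on multiples of 5 immediate.
  f₁⁻¹ f₅⁻¹ : PS
  f₁⁻¹ = φ⁻¹ 1
  f₅⁻¹ = dilate f₁⁻¹

  f₁f₁⁻¹≈1 : f₁ * f₁⁻¹ ≈ 1ₛ
  f₁f₁⁻¹≈1 = trans (*-comm f₁ f₁⁻¹) (φ-inverse 0)

  f₅⁻¹f₅≈1 : f₅⁻¹ * f₅ ≈ 1ₛ
  f₅⁻¹f₅≈1 = trans (*-congˡ (sym (dilate-φ 0))) (trans (sym (dilate-* f₁⁻¹ f₁)) (trans (dilate-cong (φ-inverse 0)) dilate-1))

  f₅f₅⁻¹≈1 : f₅ * f₅⁻¹ ≈ 1ₛ
  f₅f₅⁻¹≈1 = trans (*-comm f₅ f₅⁻¹) f₅⁻¹f₅≈1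

  -- Any inverse `g` is allowed, so that the dilated inverse of f₅ can be used for `φ⁻¹ 10`.
  φ⁻¹-double : ∀ d {g} → g * φ (suc d) ≈ 1ₛ → φ⁻¹ (suc d ℕ.* 2) ≈ g ^ 2
  φ⁻¹-double d {g} gφ≈1 = inverse-unique
    (φ-inverse (suc (d ℕ.* 2)))
    (trans (*-congˡ (φ-double d)) (trans (sym (^-distrib-* g (φ (suc d)) 2))
      (trans (^-congˡ 2 gφ≈1) (solve 0 (con true :^ 2 := con true) refl))))

  -- The solver treats a series and its inverse as independent variables; the cancelling pairs are
  -- therefore collected in explicit unit factors, which this lemma removes.
  drop-units : ∀ m n f → (f₁ * f₁⁻¹) ^ m * (f₅ * f₅⁻¹) ^ n * f ≈ f
  drop-units m n f = trans
    (*-congʳ (trans (*-cong (trans (^-congˡ m f₁f₁⁻¹≈1) (1^ m)) (trans (^-congˡ n f₅f₅⁻¹≈1) (1^ n))) (*-identityˡ 1ₛ)))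
    (*-identityˡ f)
    where
    1^ : ∀ n → 1ₛ ^ n ≈ 1ₛ
    1^ zero    = refl
    1^ (suc n) = trans (*-identityˡ _) (1^ n)

  V Z Y : PS
  V = f₁ ^ 2 * f₅⁻¹
  Z = f₁ ^ 3 * f₅⁻¹ ^ 3
  Y = f₁⁻¹ * f₅⁻¹

  -- Inserting f₅/f₅ exposes f₁ f₅ with the square cofactor f₁²/f₅⁴, so the key identity splits Z
  -- into a square and X times a square. For Y the inserted unit is f₁ f₅ over itself.
  Z-dissection : Z ≈ (V * V) * (V * V) + X * ((f₁ * f₅) * (f₁ * f₅))
  Z-dissection = begin
    f₁ ^ 3 * f₅⁻¹ ^ 3
      ≈⟨ drop-units 0 1 _ ⟨
    _ ≈⟨ solve 4 (λ f f′ h h′ → (f :* f′) :^ 0 :* (h :* h′) :^ 1 :* (f :^ 3 :* h′ :^ 3)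
           := f :^ 2 :* h′ :^ 4 :* (f :* h)) refl f₁ f₁⁻¹ f₅ f₅⁻¹ ⟩
    f₁ ^ 2 * f₅⁻¹ ^ 4 * (f₁ * f₅)
      ≈⟨ *-congˡ f₁f₅ ⟩
    f₁ ^ 2 * f₅⁻¹ ^ 4 * (f₁ ^ 6 + X * f₅ ^ 6)
      ≈⟨ solve 5 (λ x f f′ h h′ → f :^ 2 :* h′ :^ 4 :* (f :^ 6 :+ x :* h :^ 6)
           := (f :^ 2 :* h′) :^ 4 :+ (f :* f′) :^ 0 :* (h :* h′) :^ 4 :* (x :* (f :^ 2 :* h :^ 2))) refl X f₁ f₁⁻¹ f₅ f₅⁻¹ ⟩
    V ^ 4 + (f₁ * f₁⁻¹) ^ 0 * (f₅ * f₅⁻¹) ^ 4 * (X * (f₁ ^ 2 * f₅ ^ 2))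
      ≈⟨ +-congˡ (drop-units 0 4 _) ⟩
    V ^ 4 + X * (f₁ ^ 2 * f₅ ^ 2)
      ≈⟨ solve 4 (λ x f h v → v :^ 4 :+ x :* (f :^ 2 :* h :^ 2) 
           := (v :* v) :* (v :* v) :+ x :* ((f :* h) :* (f :* h))) refl X f₁ f₅ V ⟩
    (V * V) * (V * V) + X * ((f₁ * f₅) * (f₁ * f₅)) ∎
    where open ≈-Reasoning

  Y-dissection : Y ≈ V * V + X * ((f₅ ^ 2 * f₁⁻¹) * (f₅ ^ 2 * f₁⁻¹))
  Y-dissection = begin
    f₁⁻¹ * f₅⁻¹
      ≈⟨ drop-units 1 1 _ ⟨
    _ ≈⟨ solve 4 (λ f f′ h h′ → (f :* f′) :^ 1 :* (h :* h′) :^ 1 :* (f′ :* h′)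
           := f′ :^ 2 :* h′ :^ 2 :* (f :* h)) refl f₁ f₁⁻¹ f₅ f₅⁻¹ ⟩
    f₁⁻¹ ^ 2 * f₅⁻¹ ^ 2 * (f₁ * f₅)
      ≈⟨ *-congˡ f₁f₅ ⟩
    f₁⁻¹ ^ 2 * f₅⁻¹ ^ 2 * (f₁ ^ 6 + X * f₅ ^ 6)
      ≈⟨ solve 5 (λ x f f′ h h′ → f′ :^ 2 :* h′ :^ 2 :* (f :^ 6 :+ x :* h :^ 6)
           := (f :* f′) :^ 2 :* (h :* h′) :^ 0 :* ((f :^ 2 :* h′) :^ 2)
           :+ (f :* f′) :^ 0 :* (h :* h′) :^ 2 :* (x :* (h :^ 2 :* f′) :^ 2)) refl X f₁ f₁⁻¹ f₅ f₅⁻¹ ⟩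
    (f₁ * f₁⁻¹) ^ 2 * (f₅ * f₅⁻¹) ^ 0 * V ^ 2 + (f₁ * f₁⁻¹) ^ 0 * (f₅ * f₅⁻¹) ^ 2 * (X * (f₅ ^ 2 * f₁⁻¹) ^ 2)
      ≈⟨ +-cong (drop-units 2 0 _) (drop-units 0 2 _) ⟩
    V ^ 2 + X * (f₅ ^ 2 * f₁⁻¹) ^ 2
      ≈⟨ solve 3 (λ x v w → v :^ 2 :+ x :* w :^ 2 := v :* v :+ x :* (w :* w)) refl X V (f₅ ^ 2 * f₁⁻¹) ⟩
    V * V + X * ((f₅ ^ 2 * f₁⁻¹) * (f₅ ^ 2 * f₁⁻¹)) ∎
    where open ≈-Reasoning

  j₁₀-product : φ 2 ^ 1 * (φ 5 ^ 5 * (φ⁻¹ 1 ^ 1 * (φ⁻¹ 10 ^ 5 * 1ₛ))) ≈ Z * Z + X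
  j₁₀-product = begin
    φ 2 ^ 1 * (f₅ ^ 5 * (f₁⁻¹ ^ 1 * (φ⁻¹ 10 ^ 5 * 1ₛ)))
      ≈⟨ *-cong (^-congˡ 1 (φ-double 0)) (*-congˡ (*-congˡ (*-congʳ (^-congˡ 5 (φ⁻¹-double 4 f₅⁻¹f₅≈1))))) ⟩
    (f₁ ^ 2) ^ 1 * (f₅ ^ 5 * (f₁⁻¹ ^ 1 * ((f₅⁻¹ ^ 2) ^ 5 * 1ₛ)))
      ≈⟨ solve 4 (λ f f′ h h′ → (f :^ 2) :^ 1 :* (h :^ 5 :* (f′ :^ 1 :* ((h′ :^ 2) :^ 5 :* con true)))
           := (f :* f′) :^ 1 :* (h :* h′) :^ 4 :* (h′ :^ 6 :* (f :* h))) refl f₁ f₁⁻¹ f₅ f₅⁻¹ ⟩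
    _ ≈⟨ trans (drop-units 1 4 _) (*-congˡ f₁f₅) ⟩
    f₅⁻¹ ^ 6 * (f₁ ^ 6 + X * f₅ ^ 6)
      ≈⟨ solve 5 (λ x f f′ h h′ → h′ :^ 6 :* (f :^ 6 :+ x :* h :^ 6)
           := (f :^ 3 :* h′ :^ 3) :* (f :^ 3 :* h′ :^ 3) :+ (f :* f′) :^ 0 :* (h :* h′) :^ 6 :* x) refl X f₁ f₁⁻¹ f₅ f₅⁻¹ ⟩
    Z * Z + (f₁ * f₁⁻¹) ^ 0 * (f₅ * f₅⁻¹) ^ 6 * X
      ≈⟨ +-congˡ (drop-units 0 6 X) ⟩
    Z * Z + X ∎
    where open ≈-Reasoning

  j₁₀*-product : φ 1 ^ 4 * (φ 5 ^ 4 * (φ⁻¹ 2 ^ 4 * (φ⁻¹ 10 ^ 4 * 1ₛ))) ≈ (Y * Y) * (Y * Y)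
  j₁₀*-product = begin
    f₁ ^ 4 * (f₅ ^ 4 * (φ⁻¹ 2 ^ 4 * (φ⁻¹ 10 ^ 4 * 1ₛ)))
      ≈⟨ *-congˡ (*-congˡ (*-cong (^-congˡ 4 (φ⁻¹-double 0 (φ-inverse 0))) (*-congʳ (^-congˡ 4 (φ⁻¹-double 4 f₅⁻¹f₅≈1))))) ⟩
    f₁ ^ 4 * (f₅ ^ 4 * ((f₁⁻¹ ^ 2) ^ 4 * ((f₅⁻¹ ^ 2) ^ 4 * 1ₛ)))
      ≈⟨ solve 4 (λ f f′ h h′ → f :^ 4 :* (h :^ 4 :* ((f′ :^ 2) :^ 4 :* ((h′ :^ 2) :^ 4 :* con true)))
           := (f :* f′) :^ 4 :* (h :* h′) :^ 4 :* (((f′ :* h′) :* (f′ :* h′)) :* ((f′ :* h′) :* (f′ :* h′))))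
           refl f₁ f₁⁻¹ f₅ f₅⁻¹ ⟩
    _ ≈⟨ drop-units 4 4 _ ⟩
    (Y * Y) * (Y * Y) ∎
    where open ≈-Reasoning

  f₅⁻¹-Supported : Supported 0 f₅⁻¹
  f₅⁻¹-Supported = dilate-Supported f₁⁻¹

  -- The square of f₁ = α + β + γ has no cross terms, so its three parts lie in the classes 0, 2 and
  -- 4, and multiplication by `f₅⁻¹` does not move them.
  V-vanishing : ∀ n → n % 5 ≢ 0 → n % 5 ≢ 2 → n % 5 ≢ 4 → V n K.≈ K.0#
  V-vanishing n n≢0 n≢2 n≢4 = K.trans (at V≈ n) (K.trans (K.+-cong (K.+-cong
      (Supported-* (Supported-* α-Supported α-Supported) f₅⁻¹-Supported n n≢0)
      (Supported-* (Supported-* β-Supported β-Supported) f₅⁻¹-Supported n n≢2))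
      (Supported-* (Supported-* γ-Supported γ-Supported) f₅⁻¹-Supported n n≢4))
    (K.trans (K.+-identityʳ _) (K.+-identityʳ _)))
    where
    V≈ : V ≈ (α * α) * f₅⁻¹ + (β * β) * f₅⁻¹ + (γ * γ) * f₅⁻¹
    V≈ = trans (*-congʳ (^-congˡ 2 f₁-dissection)) (solve 4 (λ a b c h → (a :+ b :+ c) :^ 2 :* h
      := (a :* a) :* h :+ (b :* b) :* h :+ (c :* c) :* h) refl α β γ f₅⁻¹)

  square-vanishing : ∀ {f} n → f n K.≈ K.0# → (f * f) (n ℕ.* 2) K.≈ K.0#
  square-vanishing {f} n fn≈0 = K.trans (square-even f n) (K.trans (K.*-congʳ fn≈0) (K.zeroˡ _))

  square+X-square-vanishing : ∀ {f} g n → f n K.≈ K.0# → (f * f + X * (g * g)) (n ℕ.* 2) K.≈ K.0#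
  square+X-square-vanishing g n fn≈0 = K.trans (K.+-cong (square-vanishing n fn≈0) (X-square-even g n)) (K.+-identityʳ _)

  j₁₀-vanishing : ∀ n → V n K.≈ K.0# →
    (φ 2 ^ 1 * (φ 5 ^ 5 * (φ⁻¹ 1 ^ 1 * (φ⁻¹ 10 ^ 5 * 1ₛ)))) (n ℕ.* 2 ℕ.* 2 ℕ.* 2) K.≈ K.0#
  j₁₀-vanishing n Vn≈0 = K.trans (at j₁₀-product (n ℕ.* 2 ℕ.* 2 ℕ.* 2)) (K.trans
    (K.+-cong
      (square-vanishing {Z} (n ℕ.* 2 ℕ.* 2) (K.trans (at Z-dissection (n ℕ.* 2 ℕ.* 2))
        (square+X-square-vanishing (f₁ * f₅) (n ℕ.* 2) (square-vanishing {V} n Vn≈0))))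
      (X-even (n ℕ.* 2 ℕ.* 2)))
    (K.+-identityʳ _))
    where
    X-even : ∀ n → X (n ℕ.* 2) K.≈ K.0#
    X-even zero    = K.refl
    X-even (suc n) = K.refl

  j₁₀*-vanishing : ∀ n → V n K.≈ K.0# →
    (φ 1 ^ 4 * (φ 5 ^ 4 * (φ⁻¹ 2 ^ 4 * (φ⁻¹ 10 ^ 4 * 1ₛ)))) (n ℕ.* 2 ℕ.* 2 ℕ.* 2) K.≈ K.0#
  j₁₀*-vanishing n Vn≈0 = K.trans (at j₁₀*-product (n ℕ.* 2 ℕ.* 2 ℕ.* 2))
    (square-vanishing {Y * Y} (n ℕ.* 2 ℕ.* 2) (square-vanishing {Y} (n ℕ.* 2) (K.trans (at Y-dissection (n ℕ.* 2))
      (square+X-square-vanishing (f₅ ^ 2 * f₁⁻¹) n Vn≈0))))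

  V-coefficient : ∀ r → r % 5 ≢ 0 → r % 5 ≢ 2 → r % 5 ≢ 4 → ∀ n → V (5 ℕ.* n ℕ.+ r) K.≈ K.0#
  V-coefficient r r≢0 r≢2 r≢4 n = V-vanishing (5 ℕ.* n ℕ.+ r)
    (λ eq → r≢0 (≡.trans (≡.sym (residue r n)) eq))
    (λ eq → r≢2 (≡.trans (≡.sym (residue r n)) eq))
    (λ eq → r≢4 (≡.trans (≡.sym (residue r n)) eq))

  -- The factor 1/q makes `J10 (suc k)` the coefficient of degree `2 + k` in `P10`, and similarly
  -- for `A10`. The constants -1 and 4 enter only at index 0, and the multiple of 16 dies in
  -- characteristic 2.
  coefficients-even : ∀ m k → 2 ℕ.+ k ≡ m ℕ.* 2 ℕ.* 2 ℕ.* 2 → V m K.≈ K.0# →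
    (2 ℕ.∣ ∣ J10 (suc k) ∣) × (2 ℕ.∣ ∣ J10* (suc k) ∣)
  coefficients-even m k index Vm≈0 =
    reduce-even 1≉0 (J10 (suc k)) P10-vanishes ,
    reduce-even 1≉0 (J10* (suc k)) (begin
      reduce (A10 (2 ℕ.+ k) ℤ.+ + 16 ℤ.* B10 k)
        ≈⟨ reduce-+ (A10 (2 ℕ.+ k)) _ ⟩
      reduce (A10 (2 ℕ.+ k)) K.+ reduce (+ 16 ℤ.* B10 k)
        ≈⟨ K.+-cong A10-vanishes (K.trans (reduce-* (+ 16) (B10 k)) (K.trans (K.*-congʳ reduce-16) (K.zeroˡ _))) ⟩
      K.0# K.+ K.0#
        ≈⟨ K.+-identityʳ _ ⟩
      K.0# ∎)
    where
    open K-Reasoning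
    reduce-16 : reduce (+ 16) K.≈ K.0#
    reduce-16 = K₂.solve 0 (16 K₂.:× K₂.con true K₂.:= K₂.con false) K.refl
    at-index : ∀ f → f (m ℕ.* 2 ℕ.* 2 ℕ.* 2) K.≈ K.0# → f (2 ℕ.+ k) K.≈ K.0#
    at-index f = K.trans (K.reflexive (≡.cong f index))
    P10-vanishes : reduce (P10 (2 ℕ.+ k)) K.≈ K.0#
    P10-vanishes = at-index (reduceₛ P10) (K.trans (at reduceₛ-P10 (m ℕ.* 2 ℕ.* 2 ℕ.* 2)) (j₁₀-vanishing m Vm≈0))
    A10-vanishes : reduce (A10 (2 ℕ.+ k)) K.≈ K.0#
    A10-vanishes = at-index (reduceₛ A10) (K.trans (at reduceₛ-A10 (m ℕ.* 2 ℕ.* 2 ℕ.* 2)) (j₁₀*-vanishing m Vm≈0))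

-- A coefficient field containing a primitive fifth root of unity

-- R[t]/(t² + bt + c)
module Quadratic (R : CommutativeSemiring 0ℓ 0ℓ) (1+1≈0 : HasChar2 R) (b c : CommutativeSemiring.Carrier R) where
  private module R = CommutativeSemiring R
  open Char2 R 1+1≈0

  private
    _≈₂_ : R.Carrier × R.Carrier → R.Carrier × R.Carrier → Set
    (x , y) ≈₂ (x′ , y′) = x R.≈ x′ × y R.≈ y′

    isEquivalence : IsEquivalence _≈₂_
    isEquivalence = record
      { refl  = R.refl , R.refl
      ; sym   = λ (p , q) → R.sym p , R.sym q
      ; trans = λ (p , q) (p′ , q′) → R.trans p p′ , R.trans q q′ }

  extension : CommutativeSemiring 0ℓ 0ℓ
  extension = record
    { Carrier = R.Carrier × R.Carrier
    ; _≈_ = _≈₂_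
    ; _+_ = λ (x , y) (x′ , y′) → x R.+ x′ , y R.+ y′
    ; _*_ = λ (x , y) (x′ , y′) → x R.* x′ R.+ c R.* (y R.* y′) , x R.* y′ R.+ y R.* x′ R.+ b R.* (y R.* y′)
    ; 0# = R.0# , R.0#
    ; 1# = R.1# , R.0#
    ; isCommutativeSemiring = IsCommutativeSemiringˡ.isCommutativeSemiring record
      { +-isCommutativeMonoid = IsCommutativeMonoidˡ.isCommutativeMonoid record
        { isSemigroup = record
          { isMagma = record
            { isEquivalence = isEquivalence
            ; ∙-cong = λ (p , q) (p′ , q′) → R.+-cong p p′ , R.+-cong q q′ }
          ; assoc = λ _ _ _ → R.+-assoc _ _ _ , R.+-assoc _ _ _ }
        ; identityˡ = λ _ → R.+-identityˡ _ , R.+-identityˡ _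
        ; comm = λ _ _ → R.+-comm _ _ , R.+-comm _ _ }
      ; *-isCommutativeMonoid = IsCommutativeMonoidˡ.isCommutativeMonoid record
        { isSemigroup = record
          { isMagma = record
            { isEquivalence = isEquivalence
            ; ∙-cong = λ (p , q) (p′ , q′) →
                R.+-cong (R.*-cong p p′) (R.*-congˡ (R.*-cong q q′)) ,
                R.+-cong (R.+-cong (R.*-cong p q′) (R.*-cong q p′)) (R.*-congˡ (R.*-cong q q′)) }
          ; assoc = λ (x , y) (x′ , y′) (x″ , y″) →
              solve 8 (λ b c x y x′ y′ x″ y″ →
                (x :* x′ :+ c :* (y :* y′)) :* x″ :+ c :* ((x :* y′ :+ y :* x′ :+ b :* (y :* y′)) :* y″)
                := x :* (x′ :* x″ :+ c :* (y′ :* y″)) :+ c :* (y :* (x′ :* y″ :+ y′ :* x″ :+ b :* (y′ :* y″))))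
                R.refl b c x y x′ y′ x″ y″ ,
              solve 8 (λ b c x y x′ y′ x″ y″ →
                (x :* x′ :+ c :* (y :* y′)) :* y″ :+ (x :* y′ :+ y :* x′ :+ b :* (y :* y′)) :* x″
                  :+ b :* ((x :* y′ :+ y :* x′ :+ b :* (y :* y′)) :* y″)
                := x :* (x′ :* y″ :+ y′ :* x″ :+ b :* (y′ :* y″)) :+ y :* (x′ :* x″ :+ c :* (y′ :* y″))
                  :+ b :* (y :* (x′ :* y″ :+ y′ :* x″ :+ b :* (y′ :* y″))))
                R.refl b c x y x′ y′ x″ y″ }
        ; identityˡ = λ (x , y) →
            solve 3 (λ c x y → con true :* x :+ c :* (con false :* y) := x) R.refl c x y ,
            solve 3 (λ b x y → con true :* y :+ con false :* x :+ b :* (con false :* y) := y) R.refl b x y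
        ; comm = λ (x , y) (x′ , y′) →
            solve 5 (λ c x y x′ y′ → x :* x′ :+ c :* (y :* y′) := x′ :* x :+ c :* (y′ :* y)) R.refl c x y x′ y′ ,
            solve 5 (λ b x y x′ y′ → x :* y′ :+ y :* x′ :+ b :* (y :* y′)
              := x′ :* y :+ y′ :* x :+ b :* (y′ :* y)) R.refl b x y x′ y′ }
      ; distribʳ = λ (x″ , y″) (x , y) (x′ , y′) →
          solve 7 (λ c x y x′ y′ x″ y″ → (x :+ x′) :* x″ :+ c :* ((y :+ y′) :* y″)
            := (x :* x″ :+ c :* (y :* y″)) :+ (x′ :* x″ :+ c :* (y′ :* y″))) R.refl c x y x′ y′ x″ y″ ,
          solve 7 (λ b x y x′ y′ x″ y″ → (x :+ x′) :* y″ :+ (y :+ y′) :* x″ :+ b :* ((y :+ y′) :* y″)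
            := (x :* y″ :+ y :* x″ :+ b :* (y :* y″)) :+ (x′ :* y″ :+ y′ :* x″ :+ b :* (y′ :* y″))) R.refl b x y x′ y′ x″ y″
      ; zeroˡ = λ (x , y) →
          solve 3 (λ c x y → con false :* x :+ c :* (con false :* y) := con false) R.refl c x y ,
          solve 3 (λ b x y → con false :* y :+ con false :* x :+ b :* (con false :* y) := con false) R.refl b x y } }

  extension-char2 : HasChar2 extension
  extension-char2 = 1+1≈0 , x+x≈0 R.0#

𝔽₂ 𝔽₄ 𝔽₁₆ : CommutativeSemiring 0ℓ 0ℓ
𝔽₂-char2 : HasChar2 𝔽₂
𝔽₄-char2 : HasChar2 𝔽₄
𝔽₁₆-char2 : HasChar2 𝔽₁₆

𝔽₂ = CommutativeRing.commutativeSemiring Bool.xor-∧-commutativeRing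
𝔽₂-char2 = ≡.refl

𝔽₄ = Quadratic.extension 𝔽₂ 𝔽₂-char2 true true
𝔽₄-char2 = Quadratic.extension-char2 𝔽₂ 𝔽₂-char2 true true

-- With ω a primitive cube root of unity, ζ² + ωζ + 1 divides 1 + ζ + ζ² + ζ³ + ζ⁴.
𝔽₁₆ = Quadratic.extension 𝔽₄ 𝔽₄-char2 (false , true) (true , false)
𝔽₁₆-char2 = Quadratic.extension-char2 𝔽₄ 𝔽₄-char2 (false , true) (true , false)

-- The adjoined generator of `𝔽₁₆` over `𝔽₄`: component 0 along 1 and component 1 along t.
ζ₅ : CommutativeSemiring.Carrier 𝔽₁₆
ζ₅ = (false , false) , (true , false)


open import Data.Nat using (_+_; _*_; _≤_)
open import Data.Integer.Divisibility using (_∣_)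

theorem1p6 : (i : ℕ) → (i ≡ 7 ⊎ i ≡ 23) → (n : ℕ) → 1 ≤ n →
    ((+ 2) ∣ J10 (40 * n + i)) × ((+ 2) ∣ J10* (40 * n + i))
theorem1p6 i i≡7⊎i≡23 (suc n) _ = cases i≡7⊎i≡23
  where
  open Parity 𝔽₁₆ 𝔽₁₆-char2 ζ₅ ((≡.refl , ≡.refl) , (≡.refl , ≡.refl)) (λ ())

  -- The successor is the shift by 1/q, and the three doublings match the three successive squarings
  -- between V and the eta quotients.
  index₇ : ∀ n → suc (40 * suc n + 7) ≡ (5 * suc n + 1) * 2 * 2 * 2
  index₇ = solve-∀
  index₂₃ : ∀ n → suc (40 * suc n + 23) ≡ (5 * suc n + 3) * 2 * 2 * 2
  index₂₃ = solve-∀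

  cases : i ≡ 7 ⊎ i ≡ 23 → ((+ 2) ∣ J10 (40 * suc n + i)) × ((+ 2) ∣ J10* (40 * suc n + i))
  cases (inj₁ ≡.refl) = coefficients-even (5 * suc n + 1) _ (index₇ n) (V-coefficient 1 (λ ()) (λ ()) (λ ()) (suc n))
  cases (inj₂ ≡.refl) = coefficients-even (5 * suc n + 3) _ (index₂₃ n) (V-coefficient 3 (λ ()) (λ ()) (λ ()) (suc n))
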